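{- Let $\mathcal{T}$ be a finite tree with maximum degree $\Delta$, and $w:V(\mathcal{T})\to\mathbb{R}_{\ge0}$. Then $$\mathtt{cent}(\mathcal{T},w)\le\left(2-\frac{1}{2^{\Delta}}\right)\cdot\mathtt{OPT}(\mathcal{T},w).$$
   Context: For a subgraph $\mathcal{H}$ of $\mathcal{T}$, $w(\mathcal{H})=\sum_{x\in V(\mathcal{H})}w(x)$. A search tree on a tree $\mathcal{T}$ is a rooted tree $T$ with vertex set $V(\mathcal{T})$ defined recursively: its root is an arbitrary vertex $r$, and the children of $r$ are the roots of search trees built on the connected components of $\mathcal{T}-r$; a single-vertex tree has only itself as search tree. $\mathtt{cost}_w(T)=\sum_x w(x)\,\mathtt{depth}_T(x)$ with root depth $1$; $\mathtt{OPT}(\mathcal{T},w)$ is the minimum cost over all search trees on $\mathcal{T}$. A vertex $v$ is a centroid of $(\mathcal{T},w)$ if each component $\mathcal{H}$ of $\mathcal{T}-v$ has $w(\mathcal{H})\le w(\mathcal{T})/2$. A search tree $T$ is a centroid tree if each vertex $x$ is a centroid of $(\mathcal{T}[V(T_x)],w)$, $T_x$ being the subtree of $T$ rooted at $x$. $\mathtt{cent}(\mathcal{T},w)$ is the maximum cost of a centroid tree of $(\mathcal{T},w)$. -}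

module Defs where

open import Level using (0ℓ)
open import Data.Bool.Base using (if_then_else_)
open import Data.Nat.Base as ℕ using (ℕ; suc)
import Data.Empty as Empty
import Data.Nat.Properties as ℕ
open import Data.Integer.Base using (+_)
open import Data.Rational.Base as ℚ using (ℚ; 0ℚ; 1ℚ; ½; ∣_∣)
import Data.Rational.Properties as ℚ
open import Data.Rational.Solver using (module +-*-Solver)
open import Data.Fin.Base using (Fin)
open import Data.Fin.Properties using (_≟_)
open import Data.Fin.Subset using (Subset; Nonempty; _∈_; _⊆_; _-_; ⊤)
open import Data.Fin.Subset.Properties using (_∈?_)
open import Data.List.Base
  using (List; []; _∷_; _∷ʳ_; map; foldr; filter; length; allFin)
open import Data.List.Extrema.Nat using (max)
import Data.List.Membership.Propositional as List
open import Data.List.Relation.Unary.All as All using (All; []; _∷_)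
open import Data.List.Relation.Unary.Linked using (Linked)
open import Data.List.Relation.Unary.Unique.Propositional using (Unique)
open import Data.Product.Base using (Σ; ∃; _×_; _,_)
open import Function.Bundles using (_⇔_)
open import Relation.Binary.Core using (Rel)
open import Relation.Binary.Construct.Closure.ReflexiveTransitive using (Star)
open import Relation.Binary.Definitions
  using (Decidable; Symmetric; Irreflexive)
open import Relation.Binary.PropositionalEquality
  using (_≡_; refl; sym; cong; subst)
open import Relation.Nullary using (¬_; does)

-- Real numbers: Cauchy sequences of rationals, compared up to _≃_.

record ℝ : Set where
  constructor mkℝ
  field
    seq    : ℕ → ℚ
    cauchy : ∀ ε → 0ℚ ℚ.< ε →
             ∃ λ N → ∀ i j → N ℕ.≤ i → N ℕ.≤ j → ∣ seq i ℚ.- seq j ∣ ℚ.< ε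

open ℝ public

infix  4 _≃_ _≤_
infixl 6 _+_
infixr 7 _·_

_≃_ : Rel ℝ 0ℓ
x ≃ y = ∀ ε → 0ℚ ℚ.< ε →
        ∃ λ N → ∀ i → N ℕ.≤ i → ∣ seq x i ℚ.- seq y i ∣ ℚ.< ε

_≤_ : Rel ℝ 0ℓ
x ≤ y = ∀ ε → 0ℚ ℚ.< ε → ∃ λ N → ∀ i → N ℕ.≤ i → seq x i ℚ.< seq y i ℚ.+ ε

0ℝ : ℝ
0ℝ = mkℝ (λ _ → 0ℚ) (λ ε 0<ε → 0 , λ _ _ _ _ → 0<ε)

_+_ : ℝ → ℝ → ℝ
x + y = mkℝ (λ i → seq x i ℚ.+ seq y i) c
  where
  halves : ∀ p → ½ ℚ.* p ℚ.+ ½ ℚ.* p ≡ p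
  halves = solve 1 (λ p → con ½ :* p :+ con ½ :* p := p) refl
    where open +-*-Solver

  regroup : ∀ a b c d →
            (a ℚ.+ b) ℚ.- (c ℚ.+ d) ≡ (a ℚ.- c) ℚ.+ (b ℚ.- d)
  regroup = solve 4
    (λ a b c d → (a :+ b) :- (c :+ d) := (a :- c) :+ (b :- d)) refl
    where open +-*-Solver

  c : ∀ ε → 0ℚ ℚ.< ε →
      ∃ λ N → ∀ i j → N ℕ.≤ i → N ℕ.≤ j →
      ∣ (seq x i ℚ.+ seq y i) ℚ.- (seq x j ℚ.+ seq y j) ∣ ℚ.< ε
  c ε 0<ε
    with 0<ε/2 ← ℚ.*-monoʳ-<-pos ½ 0<ε
    with M , hx ← cauchy x (½ ℚ.* ε) 0<ε/2
    with N , hy ← cauchy y (½ ℚ.* ε) 0<ε/2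
    = M ℕ.⊔ N , λ i j i≥ j≥ → begin-strict
      ∣ (seq x i ℚ.+ seq y i) ℚ.- (seq x j ℚ.+ seq y j) ∣
        ≡⟨ cong ∣_∣ (regroup (seq x i) (seq y i) (seq x j) (seq y j)) ⟩
      ∣ (seq x i ℚ.- seq x j) ℚ.+ (seq y i ℚ.- seq y j) ∣
        ≤⟨ ℚ.∣p+q∣≤∣p∣+∣q∣ (seq x i ℚ.- seq x j) (seq y i ℚ.- seq y j) ⟩
      ∣ seq x i ℚ.- seq x j ∣ ℚ.+ ∣ seq y i ℚ.- seq y j ∣
        <⟨ ℚ.+-mono-<
             (hx i j (ℕ.m⊔n≤o⇒m≤o M N i≥) (ℕ.m⊔n≤o⇒m≤o M N j≥))
             (hy i j (ℕ.m⊔n≤o⇒n≤o M N i≥) (ℕ.m⊔n≤o⇒n≤o M N j≥)) ⟩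
      ½ ℚ.* ε ℚ.+ ½ ℚ.* ε
        ≡⟨ halves ε ⟩
      ε ∎
    where open ℚ.≤-Reasoning

_·_ : ℚ → ℝ → ℝ
q · x = mkℝ (λ i → q ℚ.* seq x i) c
  where
  K : ℚ
  K = 1ℚ ℚ.+ ∣ q ∣

  instance
    K>0 : ℚ.Positive K
    K>0 = ℚ.positive
      (ℚ.+-mono-<-≤ (ℚ.positive⁻¹ 1ℚ) (ℚ.0≤∣p∣ q))

    K≠0 : ℚ.NonZero K
    K≠0 = ℚ.pos⇒nonZero K

  ∣q∣≤K : ∣ q ∣ ℚ.≤ K
  ∣q∣≤K = subst (ℚ._≤ K) (ℚ.+-identityˡ ∣ q ∣)
    (ℚ.+-monoˡ-≤ ∣ q ∣ (ℚ.nonNegative⁻¹ 1ℚ))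

  factor : ∀ p a b → p ℚ.* a ℚ.- p ℚ.* b ≡ p ℚ.* (a ℚ.- b)
  factor = solve 3 (λ p a b → p :* a :- p :* b := p :* (a :- b)) refl
    where open +-*-Solver

  c : ∀ ε → 0ℚ ℚ.< ε →
      ∃ λ N → ∀ i j → N ℕ.≤ i → N ℕ.≤ j →
      ∣ q ℚ.* seq x i ℚ.- q ℚ.* seq x j ∣ ℚ.< ε
  c ε 0<ε
    with N , h ← cauchy x (ℚ.1/ K ℚ.* ε)
           (subst (ℚ._< ℚ.1/ K ℚ.* ε) (ℚ.*-zeroʳ (ℚ.1/ K))
             (ℚ.*-monoʳ-<-pos (ℚ.1/ K) {{ℚ.1/pos⇒pos K}} 0<ε))
    = N , λ i j i≥ j≥ → let d = seq x i ℚ.- seq x j in begin-strict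
      ∣ q ℚ.* seq x i ℚ.- q ℚ.* seq x j ∣
        ≡⟨ cong ∣_∣ (factor q (seq x i) (seq x j)) ⟩
      ∣ q ℚ.* d ∣
        ≡⟨ ℚ.∣p*q∣≡∣p∣*∣q∣ q d ⟩
      ∣ q ∣ ℚ.* ∣ d ∣
        ≤⟨ ℚ.*-monoʳ-≤-nonNeg ∣ d ∣ {{ℚ.∣-∣-nonNeg d}} ∣q∣≤K ⟩
      K ℚ.* ∣ d ∣
        <⟨ ℚ.*-monoʳ-<-pos K (h i j i≥ j≥) ⟩
      K ℚ.* (ℚ.1/ K ℚ.* ε)
        ≡⟨ sym (ℚ.*-assoc K (ℚ.1/ K) ε) ⟩
      (K ℚ.* ℚ.1/ K) ℚ.* ε
        ≡⟨ cong (ℚ._* ε) (ℚ.*-inverseʳ K) ⟩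
      1ℚ ℚ.* ε
        ≡⟨ ℚ.*-identityˡ ε ⟩
      ε ∎
    where open ℚ.≤-Reasoning

sumOver : ∀ {n} → Subset n → (Fin n → ℝ) → ℝ
sumOver {n} S f = foldr _+_ 0ℝ (map f (filter (_∈? S) (allFin n)))

1/2^_ : ℕ → ℚ
1/2^ k = ℚ._/_ (+ 1) (2 ℕ.^ k) {{ℕ.m^n≢0 2 k}}

record Graph (n : ℕ) : Set₁ where
  field
    Adj     : Rel (Fin n) 0ℓ
    adj?    : Decidable Adj
    symm    : Symmetric Adj
    irrefl  : Irreflexive _≡_ Adj

module _ {n : ℕ} (G : Graph n) where

  open Graph G

  degree : Fin n → ℕ
  degree v = length (filter (adj? v) (allFin n))

  maxDegree : ℕ
  maxDegree = max 0 (map degree (allFin n))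

  -- Vertex subsets stand for the subgraphs they induce.

  AdjIn : Subset n → Rel (Fin n) 0ℓ
  AdjIn S u v = Adj u v × u ∈ S × v ∈ S

  Connected : Subset n → Set
  Connected S = Nonempty S × (∀ {u v} → u ∈ S → v ∈ S → Star (AdjIn S) u v)

  IsCycle : List (Fin n) → Set
  IsCycle []       = Empty.⊥
  IsCycle (v ∷ vs) =
    2 ℕ.≤ length vs × Unique (v ∷ vs) × Linked Adj ((v ∷ vs) ∷ʳ v)

  IsTree : Set
  IsTree = Connected ⊤ × (∀ vs → ¬ IsCycle vs)

  IsComponent : Subset n → Subset n → Set
  IsComponent S H =
    H ⊆ S × Connected H × (∀ K → H ⊆ K → K ⊆ S → Connected K → K ⊆ H)

  -- S is the vertex set of the tree.  The list Hs enumerates the components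
  -- of S - root without repetition, and there is one child for each of them.

  data SearchTree (S : Subset n) : Set where
    node : (r : Fin n) → r ∈ S →
           (Hs : List (Subset n)) → Unique Hs →
           (∀ H → H List.∈ Hs ⇔ IsComponent (S - r) H) →
           All SearchTree Hs →
           SearchTree S

  root : ∀ {S} → SearchTree S → Fin n
  root (node r _ _ _ _ _) = r

  -- T′ ≼ T: T′ is the full subtree of T at one of its vertices.
  data _≼_ {S′} (T′ : SearchTree S′) : ∀ {S} → SearchTree S → Set where
    here  : T′ ≼ T′
    below : ∀ {S r r∈S Hs uniq comps} {Ts : All SearchTree Hs} {H}
            (H∈Hs : H List.∈ Hs) →
            T′ ≼ All.lookup Ts H∈Hs →
            T′ ≼ node {S} r r∈S Hs uniq comps Ts

  -- The depth of the root is 1; the value is only meaningful for vertices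
  -- of the tree.

  depth  : ∀ {S} → SearchTree S → Fin n → ℕ
  depths : ∀ {Hs} → All SearchTree Hs → Fin n → ℕ

  depth (node r _ _ _ _ Ts) x =
    if does (x ≟ r) then 1 else suc (depths Ts x)

  depths []                x = 0
  depths (_∷_ {x = H} T Ts) x =
    if does (x ∈? H) then depth T x else depths Ts x

  module _ (w : Fin n → ℝ) where

    cost : ∀ {S} → SearchTree S → ℝ
    cost {S} T = sumOver S (λ x → (+ depth T x ℚ./ 1) · w x)

    IsCentroid : Subset n → Fin n → Set
    IsCentroid S v =
      v ∈ S × (∀ H → IsComponent (S - v) H → sumOver H w ≤ ½ · sumOver S w)

    IsCentroidTree : ∀ {S} → SearchTree S → Set
    IsCentroidTree T =
      ∀ {S′} (T′ : SearchTree S′) → T′ ≼ T → IsCentroid S′ (root T′)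

    IsOPT : ℝ → Set
    IsOPT o =
      (Σ (SearchTree ⊤) λ T → cost T ≃ o) ×
      (∀ (T : SearchTree ⊤) → o ≤ cost T)

    IsCent : ℝ → Set
    IsCent c =
      (Σ (SearchTree ⊤) λ T → IsCentroidTree T × cost T ≃ c) ×
      (∀ (T : SearchTree ⊤) → IsCentroidTree T → cost T ≤ c)

{-# OPTIONS --safe #-}
module Submission where

-- Compare a centroid tree C with an arbitrary search tree T, by induction on C.
-- Let r be the root of T restricted to the vertex set V of C, and follow the
-- path c₁, c₂, … of C towards r for Δ + 1 steps, through subtrees on the sets
-- V = S₁ ⊃ S₂ ⊃ …  The weights halve along the path, so the sets S₁, …, S_{Δ+1}
-- contribute at most (2 - 2^-Δ) w(V) to the cost of C, and the parts hanging off
-- the path are handled by induction. It remains to see that the restrictions of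
-- T to these parts save at least w(V) over T. The vertex r alone saves the weight
-- of V, except for the last set S′ = S_{Δ+2} if r still lies in it. In that case
-- each of the Δ + 1 layers S_i ─ S_{i+1} is connected in V - r and at least as
-- heavy as S′. As r has at most Δ neighbours, two layers lie in one component
-- of V - r. The root of T restricted to that component misses one of the two
-- layers, and saves the weight of that layer once more.
--
-- Restrictions of T are never built: T enters only through its ancestor sets,
-- and its restriction to K costs each x in K the number of ancestors of x in K.

open import Defs
open import Algebra.Bundles using (CommutativeMonoid)
open import Data.Bool.Base using (if_then_else_; true; false)
open import Data.Nat.Base as ℕ using (ℕ; zero; suc; z≤n; s≤s)
import Data.Nat.Properties as ℕ
open import Data.Nat.Solver using (module +-*-Solver)
open import Data.Integer.Base as ℤ using (+_)
import Data.Integer.Properties as ℤ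
open import Data.Rational.Base as ℚ using (ℚ; 0ℚ; 1ℚ; ½; _/_)
import Data.Rational.Properties as ℚ
open import Data.Rational.Solver using () renaming (module +-*-Solver to ℚ-Solver)
import Data.Rational.Unnormalised.Base as ℚᵘ
import Data.Rational.Unnormalised.Properties as ℚᵘ
open import Data.Fin.Base using (Fin; zero; suc; toℕ)
open import Data.Fin.Properties as Fin using (_≟_; any?; all?; pigeonhole; sequence)
open import Data.Fin.Subset
  using (Subset; inside; outside; _∈_; _∉_; _⊆_; _─_; _-_; _∪_; _∩_; ⁅_⁆; ⊥; ⊤; ∣_∣)
open import Data.Fin.Subset.Properties
open import Data.List.Base
  using (List; []; _∷_; foldr; map; filter; tabulate; allFin; lookup)
open import Data.List.Extrema.Nat using (xs≤max)
import Data.List.Membership.Propositional as List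
open import Data.List.Membership.Propositional.Properties using (∈-map⁺; ∈-filter⁺; ∈-allFin)
open import Data.List.Relation.Unary.All as All using (All; []; _∷_)
open import Data.List.Relation.Unary.AllPairs using (_∷_)
open import Data.List.Relation.Unary.Any as Any using (Any; here; there)
open import Data.List.Relation.Unary.Any.Properties using (lookup-index)
open import Data.List.Relation.Unary.Unique.Propositional using (Unique)
open import Data.Product.Base using (∃; _,_; proj₁; proj₂) renaming (_×_ to _∧_)
open import Data.Sum.Base using (_⊎_; inj₁; inj₂)
open import Data.Vec.Base as Vec using (_∷_; here; there)
open import Data.Vec.Properties using (lookup∘tabulate; lookup⇒[]=; []=⇒lookup)
open import Effect.Monad using (module RawMonad)
open import Function.Base using (_∘_; id)
open import Function.Bundles using (Equivalence; _⇔_)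
open import Relation.Binary.PropositionalEquality
open import Relation.Nullary
  using (¬_; Dec; yes; no; does; contradiction; ¬¬-excluded-middle)
open import Relation.Nullary.Decidable
  using (dec-true; decidable-stable; _×-dec_; _→-dec_)
open import Relation.Nullary.Negation using (¬¬-Monad; ¬¬-map)
open import Relation.Unary using (Decidable)

-- Natural combinations in a commutative monoid

χ : ∀ {n} → Subset n → Fin n → ℕ
χ S x = if does (x ∈? S) then 1 else 0

χ-∈ : ∀ {n} {S : Subset n} {x} → x ∈ S → χ S x ≡ 1
χ-∈ {S = S} {x} x∈S with x ∈? S
... | yes _  = refl
... | no x∉S = contradiction x∈S x∉S

χ-∉ : ∀ {n} {S : Subset n} {x} → x ∉ S → χ S x ≡ 0
χ-∉ {S = S} {x} x∉S with x ∈? S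
... | yes x∈S = contradiction x∈S x∉S
... | no _    = refl

χ≤1 : ∀ {n} (S : Subset n) x → χ S x ℕ.≤ 1
χ≤1 S x with does (x ∈? S)
... | true  = ℕ.≤-refl
... | false = z≤n

χ-mono : ∀ {n} {S S′ : Subset n} {x} → (x ∈ S → x ∈ S′) → χ S x ℕ.≤ χ S′ x
χ-mono {S = S} {x = x} S⇒S′ with x ∈? S
... | no _    = z≤n
... | yes x∈S = ℕ.≤-reflexive (sym (χ-∈ (S⇒S′ x∈S)))

χ-cover : ∀ {n} {S H D : Subset n} {x} → (x ∈ S → x ∉ H → x ∈ D) → χ S x ℕ.≤ χ D x ℕ.+ χ H x
χ-cover {S = S} {H} {D} {x} cover with x ∈? H
... | yes _  = ℕ.≤-trans (χ≤1 S x) (ℕ.m≤n+m 1 (χ D x))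
... | no x∉H = ℕ.m≤n⇒m≤n+o 0 (χ-mono λ x∈S → cover x∈S x∉H)

infixl 6 _⊕_
infixr 7 _⊙_

_⊕_ : ∀ {n} → (Fin n → ℕ) → (Fin n → ℕ) → Fin n → ℕ
(a ⊕ b) x = a x ℕ.+ b x

_⊙_ : ∀ {n} → ℕ → (Fin n → ℕ) → Fin n → ℕ
(k ⊙ a) x = k ℕ.* a x

module Combination {c ℓ} (M : CommutativeMonoid c ℓ)
                   {n} (m : Fin n → CommutativeMonoid.Carrier M) where

  open CommutativeMonoid M renaming (refl to ≈-refl; sym to ≈-sym; trans to ≈-trans)
  open import Algebra.Properties.Monoid.Mult monoid using (_×_; ×-homo-+; ×-congˡ; ×-assocˡ)
  open import Algebra.Properties.CommutativeMonoid.Sum M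
    using (sum; sum-cong-≋; sum-replicate-zero; ∑-distrib-+)

  combine : (Fin n → ℕ) → Carrier
  combine a = sum (λ x → a x × m x)

  combine-cong : ∀ {a b} → (∀ x → a x ≡ b x) → combine a ≈ combine b
  combine-cong a≗b = sum-cong-≋ (λ x → ×-congˡ (a≗b x))

  combine-⊕ : ∀ a b → combine (a ⊕ b) ≈ combine a ∙ combine b
  combine-⊕ a b = ≈-trans
    (sum-cong-≋ (λ x → ×-homo-+ (m x) (a x) (b x)))
    (∑-distrib-+ (λ x → a x × m x) (λ x → b x × m x))

  combine-⊙ : ∀ k a → combine (k ⊙ a) ≈ k × combine a
  combine-⊙ zero    a = sum-replicate-zero n
  combine-⊙ (suc k) a = ≈-trans (combine-⊕ a (k ⊙ a)) (∙-congˡ (combine-⊙ k a))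

  combine-χ : ∀ S (a : Fin n → ℕ) →
              foldr _∙_ ε (map (λ x → a x × m x) (filter (_∈? S) (allFin n))) ≈
              combine (λ x → χ S x ℕ.* a x)
  combine-χ S a = go id
    where
    -- `allFin n` is `tabulate id`; an arbitrary `g` lets the induction pass to `g ∘ suc`.
    go : ∀ {k} (g : Fin k → Fin n) →
         foldr _∙_ ε (map (λ x → a x × m x) (filter (_∈? S) (tabulate g))) ≈
         sum (λ x → (χ S (g x) ℕ.* a (g x)) × m (g x))
    go {zero}  g = ≈-refl
    go {suc k} g with does (g zero ∈? S)
    ... | false = ≈-trans (go (g ∘ suc)) (≈-sym (identityˡ _))
    ... | true  = ∙-cong (×-congˡ (sym (ℕ.*-identityˡ (a (g zero))))) (go (g ∘ suc))

open import Algebra.Properties.Monoid.Mult ℚ.+-0-monoid using (_×_; ×-homo-+)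
open import Algebra.Properties.CommutativeMonoid.Sum ℚ.+-0-commutativeMonoid using (sum)

-- Rational multiples

suc/1 : ∀ k → + suc k / 1 ≡ 1ℚ ℚ.+ + k / 1
-- `_/_` cancels a gcd, which does not compute for a variable `k`; among unnormalised rationals the
-- equation is integer arithmetic.
suc/1 k = ℚ.toℚᵘ-injective (begin
  ℚ.toℚᵘ (+ suc k / 1)                    ≈⟨ ℚ.toℚᵘ-fromℚᵘ (ℚᵘ.mkℚᵘ (+ suc k) 0) ⟩
  ℚᵘ.mkℚᵘ (+ suc k) 0                     ≈⟨ ℚᵘ.*≡* (cong (λ j → (+ 1 ℤ.+ j) ℤ.* + 1) (sym (ℤ.*-identityʳ (+ k)))) ⟩
  ℚᵘ.1ℚᵘ ℚᵘ.+ ℚᵘ.mkℚᵘ (+ k) 0             ≈⟨ ℚᵘ.+-congʳ ℚᵘ.1ℚᵘ (ℚ.toℚᵘ-fromℚᵘ (ℚᵘ.mkℚᵘ (+ k) 0)) ⟨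
  ℚᵘ.1ℚᵘ ℚᵘ.+ ℚ.toℚᵘ (+ k / 1)            ≈⟨ ℚ.toℚᵘ-homo-+ 1ℚ (+ k / 1) ⟨
  ℚ.toℚᵘ (1ℚ ℚ.+ + k / 1)                 ∎)
  where open ℚᵘ.≃-Reasoning

d/1*1/d : ∀ d .{{_ : ℕ.NonZero d}} → (+ d / 1) ℚ.* (+ 1 / d) ≡ 1ℚ
d/1*1/d (suc d) = ℚ.toℚᵘ-injective (begin
  ℚ.toℚᵘ ((+ suc d / 1) ℚ.* (+ 1 / suc d))
    ≈⟨ ℚ.toℚᵘ-homo-* (+ suc d / 1) (+ 1 / suc d) ⟩
  ℚ.toℚᵘ (+ suc d / 1) ℚᵘ.* ℚ.toℚᵘ (+ 1 / suc d)
    ≈⟨ ℚᵘ.*-cong (ℚ.toℚᵘ-fromℚᵘ (ℚᵘ.mkℚᵘ (+ suc d) 0)) (ℚ.toℚᵘ-fromℚᵘ (ℚᵘ.mkℚᵘ (+ 1) d)) ⟩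
  ℚᵘ.mkℚᵘ (+ suc d) 0 ℚᵘ.* ℚᵘ.mkℚᵘ (+ 1) d
    ≈⟨ ℚᵘ.*≡* (trans (ℤ.*-identityʳ _) (trans (ℤ.*-identityʳ _)
         (sym (trans (ℤ.*-identityˡ _) (cong (+_ ∘ suc) (ℕ.+-identityʳ d)))))) ⟩
  ℚᵘ.1ℚᵘ ∎)
  where open ℚᵘ.≃-Reasoning

-- Links the rational factors in `cost` with the iterated sums used in `combine`.
*≡× : ∀ k p → (+ k / 1) ℚ.* p ≡ k × p
*≡× zero    p = ℚ.*-zeroˡ p
*≡× (suc k) p = begin
  (+ suc k / 1) ℚ.* p            ≡⟨ cong (ℚ._* p) (suc/1 k) ⟩
  (1ℚ ℚ.+ + k / 1) ℚ.* p         ≡⟨ ℚ.*-distribʳ-+ p 1ℚ (+ k / 1) ⟩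
  1ℚ ℚ.* p ℚ.+ (+ k / 1) ℚ.* p   ≡⟨ cong₂ ℚ._+_ (ℚ.*-identityˡ p) (*≡× k p) ⟩
  p ℚ.+ k × p                    ∎
  where open ≡-Reasoning

×-1ℚ : ∀ k → k × 1ℚ ≡ + k / 1
×-1ℚ k = trans (sym (*≡× k 1ℚ)) (ℚ.*-identityʳ (+ k / 1))

-- With N = 2^Δ and d = 2N - 1, the quotient d / N is 2 - 2^-Δ. Clearing the denominator N keeps
-- every coefficient a natural number.
×-ratio : ∀ Δ d p → suc d ≡ 2 ℕ.* 2 ℕ.^ Δ →
          d × p ≡ (2 ℕ.^ Δ) × (((+ 2 / 1) ℚ.- 1/2^ Δ) ℚ.* p)
×-ratio Δ d p 1+d≡2N = begin
  d × p                                          ≡⟨ *≡× d p ⟨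
  (+ d / 1) ℚ.* p                                ≡⟨ cong (ℚ._* p) d≡ ⟩
  ((+ N / 1) ℚ.* ((+ 2 / 1) ℚ.- 1/2^ Δ)) ℚ.* p   ≡⟨ ℚ.*-assoc (+ N / 1) _ p ⟩
  (+ N / 1) ℚ.* (((+ 2 / 1) ℚ.- 1/2^ Δ) ℚ.* p)   ≡⟨ *≡× N _ ⟩
  N × (((+ 2 / 1) ℚ.- 1/2^ Δ) ℚ.* p)             ∎
  where
  open ≡-Reasoning
  open ℚ-Solver
  N = 2 ℕ.^ Δ

  1+d≡N+N : 1ℚ ℚ.+ + d / 1 ≡ + N / 1 ℚ.+ + N / 1
  1+d≡N+N = begin
    1ℚ ℚ.+ + d / 1            ≡⟨ suc/1 d ⟨
    + suc d / 1               ≡⟨ ×-1ℚ (suc d) ⟨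
    suc d × 1ℚ                ≡⟨ cong (_× 1ℚ) (trans 1+d≡2N (cong (N ℕ.+_) (ℕ.+-identityʳ N))) ⟩
    (N ℕ.+ N) × 1ℚ            ≡⟨ ×-homo-+ 1ℚ N N ⟩
    N × 1ℚ ℚ.+ N × 1ℚ         ≡⟨ cong₂ ℚ._+_ (×-1ℚ N) (×-1ℚ N) ⟩
    + N / 1 ℚ.+ + N / 1       ∎

  d≡ : + d / 1 ≡ (+ N / 1) ℚ.* ((+ 2 / 1) ℚ.- 1/2^ Δ)
  d≡ = begin
    + d / 1
      ≡⟨ solve 1 (λ d → d := (con 1ℚ :+ d) :- con 1ℚ) refl (+ d / 1) ⟩
    (1ℚ ℚ.+ + d / 1) ℚ.- 1ℚ
      ≡⟨ cong₂ ℚ._-_ 1+d≡N+N (sym (d/1*1/d N {{ℕ.m^n≢0 2 Δ}})) ⟩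
    (+ N / 1 ℚ.+ + N / 1) ℚ.- (+ N / 1) ℚ.* 1/2^ Δ
      ≡⟨ solve 2 (λ m q → (m :+ m) :- m :* q := m :* (con (+ 2 / 1) :- q)) refl (+ N / 1) (1/2^ Δ) ⟩
    (+ N / 1) ℚ.* ((+ 2 / 1) ℚ.- 1/2^ Δ) ∎

half+half : ∀ p → ½ ℚ.* p ℚ.+ ½ ℚ.* p ≡ p
half+half = solve 1 (λ p → con ½ :* p :+ con ½ :* p := p) refl
  where open ℚ-Solver

-- Asymptotic order of rational sequences

-- The relation x ≤ y on the reals is seq x ≲ seq y.

infix 4 _≲_

record _≲_ (s t : ℕ → ℚ) : Set where
  constructor eventually
  field bound : ∀ ε → 0ℚ ℚ.< ε → ∃ λ N → ∀ i → N ℕ.≤ i → s i ℚ.< t i ℚ.+ ε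

open _≲_ public

∣p-q∣<ε⇒p<q+ε : ∀ p q {ε} → ℚ.∣ p ℚ.- q ∣ ℚ.< ε → p ℚ.< q ℚ.+ ε
∣p-q∣<ε⇒p<q+ε p q {ε} h = begin-strict
  p                      ≡⟨ solve 2 (λ p q → p := q :+ (p :- q)) refl p q ⟩
  q ℚ.+ (p ℚ.- q)        ≤⟨ ℚ.+-monoʳ-≤ q (p≤∣p∣ (p ℚ.- q)) ⟩
  q ℚ.+ ℚ.∣ p ℚ.- q ∣    <⟨ ℚ.+-monoʳ-< q h ⟩
  q ℚ.+ ε                ∎
  where
  open ℚ.≤-Reasoning
  open ℚ-Solver
  p≤∣p∣ : ∀ p → p ℚ.≤ ℚ.∣ p ∣
  p≤∣p∣ p with ℚ.≤-total 0ℚ p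
  ... | inj₁ 0≤p = ℚ.≤-reflexive (sym (ℚ.0≤p⇒∣p∣≡p 0≤p))
  ... | inj₂ p≤0 = ℚ.≤-trans p≤0 (ℚ.0≤∣p∣ p)

≃⇒≲ : ∀ x y → x ≃ y → seq x ≲ seq y
≃⇒≲ x y x≃y = eventually λ ε 0<ε → let N , h = x≃y ε 0<ε in
  N , λ i i≥ → ∣p-q∣<ε⇒p<q+ε (seq x i) (seq y i) (h i i≥)

≃⇒≳ : ∀ x y → x ≃ y → seq y ≲ seq x
≃⇒≳ x y x≃y = eventually λ ε 0<ε → let N , h = x≃y ε 0<ε in
  N , λ i i≥ → ∣p-q∣<ε⇒p<q+ε (seq y i) (seq x i)
    (subst (ℚ._< ε) (trans (sym (ℚ.∣-p∣≡∣p∣ (seq x i ℚ.- seq y i)))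
      (cong ℚ.∣_∣ (solve 2 (λ p q → :- (p :- q) := q :- p) refl (seq x i) (seq y i)))) (h i i≥))
  where open ℚ-Solver

≲-reflexive : ∀ {s t} → (∀ i → s i ≡ t i) → s ≲ t
≲-reflexive {s} {t} s≗t = eventually λ ε 0<ε → 0 , λ i _ → begin-strict
  s i          ≡⟨ s≗t i ⟩
  t i          ≡⟨ ℚ.+-identityʳ (t i) ⟨
  t i ℚ.+ 0ℚ   <⟨ ℚ.+-monoʳ-< (t i) 0<ε ⟩
  t i ℚ.+ ε    ∎
  where open ℚ.≤-Reasoning

≲-trans : ∀ {s t u} → s ≲ t → t ≲ u → s ≲ u
bound (≲-trans {s} {t} {u} s≲t t≲u) ε 0<ε
  with 0<ε/2 ← ℚ.*-monoʳ-<-pos ½ 0<ε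
  with M , hs ← bound s≲t (½ ℚ.* ε) 0<ε/2
  with N , ht ← bound t≲u (½ ℚ.* ε) 0<ε/2
  = M ℕ.⊔ N , λ i i≥ → begin-strict
    s i                                ≤⟨ ℚ.<⇒≤ (hs i (ℕ.m⊔n≤o⇒m≤o M N i≥)) ⟩
    t i ℚ.+ ½ ℚ.* ε                    <⟨ ℚ.+-monoˡ-< (½ ℚ.* ε) (ht i (ℕ.m⊔n≤o⇒n≤o M N i≥)) ⟩
    (u i ℚ.+ ½ ℚ.* ε) ℚ.+ ½ ℚ.* ε      ≡⟨ ℚ.+-assoc (u i) _ _ ⟩
    u i ℚ.+ (½ ℚ.* ε ℚ.+ ½ ℚ.* ε)      ≡⟨ cong (u i ℚ.+_) (half+half ε) ⟩
    u i ℚ.+ ε                          ∎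
  where open ℚ.≤-Reasoning

infixl 6 _∔_

_∔_ : (ℕ → ℚ) → (ℕ → ℚ) → ℕ → ℚ
(s ∔ t) i = s i ℚ.+ t i

∔-mono : ∀ {s t u v} → s ≲ t → u ≲ v → s ∔ u ≲ t ∔ v
bound (∔-mono {s} {t} {u} {v} s≲t u≲v) ε 0<ε
  with 0<ε/2 ← ℚ.*-monoʳ-<-pos ½ 0<ε
  with M , hs ← bound s≲t (½ ℚ.* ε) 0<ε/2
  with N , hu ← bound u≲v (½ ℚ.* ε) 0<ε/2
  = M ℕ.⊔ N , λ i i≥ → begin-strict
    s i ℚ.+ u i
      <⟨ ℚ.+-mono-< (hs i (ℕ.m⊔n≤o⇒m≤o M N i≥)) (hu i (ℕ.m⊔n≤o⇒n≤o M N i≥)) ⟩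
    (t i ℚ.+ ½ ℚ.* ε) ℚ.+ (v i ℚ.+ ½ ℚ.* ε)
      ≡⟨ solve 3 (λ t v e → (t :+ e) :+ (v :+ e) := (t :+ v) :+ (e :+ e)) refl
           (t i) (v i) (½ ℚ.* ε) ⟩
    (t i ℚ.+ v i) ℚ.+ (½ ℚ.* ε ℚ.+ ½ ℚ.* ε)
      ≡⟨ cong (t i ℚ.+ v i ℚ.+_) (half+half ε) ⟩
    (t i ℚ.+ v i) ℚ.+ ε ∎
  where
  open ℚ.≤-Reasoning
  open ℚ-Solver

∔-cancelʳ : ∀ {s t} u → s ∔ u ≲ t ∔ u → s ≲ t
bound (∔-cancelʳ {s} {t} u h) ε 0<ε with N , h′ ← bound h ε 0<ε = N , λ i i≥ → begin-strict
  s i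
    ≡⟨ solve 2 (λ s u → s := (s :+ u) :- u) refl (s i) (u i) ⟩
  (s i ℚ.+ u i) ℚ.- u i
    <⟨ ℚ.+-monoˡ-< (ℚ.- u i) (h′ i i≥) ⟩
  (t i ℚ.+ u i ℚ.+ ε) ℚ.- u i
    ≡⟨ solve 3 (λ t u e → (t :+ u :+ e) :- u := t :+ e) refl (t i) (u i) ε ⟩
  t i ℚ.+ ε ∎
  where
  open ℚ.≤-Reasoning
  open ℚ-Solver

∔-nonNeg : ∀ {s t} → (λ _ → 0ℚ) ≲ s → (λ _ → 0ℚ) ≲ t → (λ _ → 0ℚ) ≲ s ∔ t
∔-nonNeg 0≲s 0≲t = ≲-trans (≲-reflexive λ _ → refl) (∔-mono 0≲s 0≲t)

×-monoʳ-≲ : ∀ k {s t} → s ≲ t → (λ i → k × s i) ≲ (λ i → k × t i)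
×-monoʳ-≲ zero    s≲t = ≲-reflexive λ _ → refl
×-monoʳ-≲ (suc k) s≲t = ∔-mono s≲t (×-monoʳ-≲ k s≲t)

×-nonNeg : ∀ k {s} → (λ _ → 0ℚ) ≲ s → (λ _ → 0ℚ) ≲ (λ i → k × s i)
×-nonNeg zero    0≲s = ≲-reflexive λ _ → refl
×-nonNeg (suc k) 0≲s = ∔-nonNeg 0≲s (×-nonNeg k 0≲s)

sum-nonNeg : ∀ {n} (s : Fin n → ℕ → ℚ) → (∀ x → (λ _ → 0ℚ) ≲ s x) →
             (λ _ → 0ℚ) ≲ (λ i → sum (λ x → s x i))
sum-nonNeg {zero}  s 0≲s = ≲-reflexive λ _ → refl
sum-nonNeg {suc n} s 0≲s = ∔-nonNeg (0≲s zero) (sum-nonNeg (s ∘ suc) (0≲s ∘ suc))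

×-cancel-≲ : ∀ k .{{_ : ℕ.NonZero k}} {s t} → (λ i → k × s i) ≲ (λ i → k × t i) → s ≲ t
bound (×-cancel-≲ k@(suc _) {s} {t} h) ε 0<ε
  -- The tolerance is scaled by `k`, so that division by `k` leaves `ε`.
  with 0<kε ← subst (ℚ._< (+ k / 1) ℚ.* ε) (ℚ.*-zeroʳ (+ k / 1))
                (ℚ.*-monoʳ-<-pos (+ k / 1) {{ℚ.normalize-pos k 1}} 0<ε)
  with N , h′ ← bound h ((+ k / 1) ℚ.* ε) 0<kε
  = N , λ i i≥ → ℚ.*-cancelˡ-<-nonNeg (+ k / 1) {{ℚ.normalize-nonNeg k 1}} (begin-strict
    (+ k / 1) ℚ.* s i                        ≡⟨ *≡× k (s i) ⟩
    k × s i                                  <⟨ h′ i i≥ ⟩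
    k × t i ℚ.+ (+ k / 1) ℚ.* ε              ≡⟨ cong (ℚ._+ (+ k / 1) ℚ.* ε) (*≡× k (t i)) ⟨
    (+ k / 1) ℚ.* t i ℚ.+ (+ k / 1) ℚ.* ε    ≡⟨ ℚ.*-distribˡ-+ (+ k / 1) (t i) ε ⟨
    (+ k / 1) ℚ.* (t i ℚ.+ ε)                ∎)
  where open ℚ.≤-Reasoning

seq-foldr : ∀ {A : Set} (f : A → ℝ) (g : A → ℕ → ℚ) → (∀ x i → seq (f x) i ≡ g x i) → ∀ i xs →
            seq (foldr _+_ 0ℝ (map f xs)) i ≡ foldr ℚ._+_ 0ℚ (map (λ x → g x i) xs)
seq-foldr f g f≗g i []       = refl
seq-foldr f g f≗g i (x ∷ xs) = cong₂ ℚ._+_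
  {x = seq (f x) i} {y = g x i}
  {u = seq (foldr _+_ 0ℝ (map f xs)) i} {v = foldr ℚ._+_ 0ℚ (map (λ x → g x i) xs)}
  (f≗g x i) (seq-foldr f g f≗g i xs)

-- Every quantity in the proof is a natural combination of the weights; the
-- combinations are compared through their coefficients.

module Weighted {n} (w : Fin n → ℝ) where

  open module At i = Combination ℚ.+-0-commutativeMonoid (λ x → seq (w x) i)
    using (combine; combine-cong; combine-⊕; combine-⊙; combine-χ)

  ⟦_⟧ : (Fin n → ℕ) → ℕ → ℚ
  ⟦ a ⟧ i = combine i a

  infix 4 _⊑_

  -- A record, so that both coefficient functions can be inferred although `⟦_⟧` unfolds.
  record _⊑_ (a b : Fin n → ℕ) : Set where
    constructor ⟪_⟫
    field weigh : ⟦ a ⟧ ≲ ⟦ b ⟧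

  open _⊑_ public

  ⊑-trans : ∀ {a b c} → a ⊑ b → b ⊑ c → a ⊑ c
  ⊑-trans ⟪ a⊑b ⟫ ⟪ b⊑c ⟫ = ⟪ ≲-trans a⊑b b⊑c ⟫

  ⊕-mono : ∀ {a b c d} → a ⊑ b → c ⊑ d → a ⊕ c ⊑ b ⊕ d
  ⊕-mono {a} {b} {c} {d} ⟪ a⊑b ⟫ ⟪ c⊑d ⟫ = ⟪
    ≲-trans (≲-reflexive (λ i → combine-⊕ i a c)) (≲-trans (∔-mono a⊑b c⊑d)
      (≲-reflexive λ i → sym (combine-⊕ i b d))) ⟫

  ⊕-cancelʳ : ∀ {a b} c → a ⊕ c ⊑ b ⊕ c → a ⊑ b
  ⊕-cancelʳ {a} {b} c ⟪ h ⟫ = ⟪ ∔-cancelʳ ⟦ c ⟧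
    (≲-trans (≲-reflexive λ i → sym (combine-⊕ i a c)) (≲-trans h (≲-reflexive (λ i → combine-⊕ i b c)))) ⟫

  sumOver-/1≡⟦⟧ : ∀ S (a : Fin n → ℕ) i →
                  seq (sumOver S (λ x → (+ a x / 1) · w x)) i ≡ ⟦ (λ x → χ S x ℕ.* a x) ⟧ i
  sumOver-/1≡⟦⟧ S a i = trans
    (seq-foldr (λ x → (+ a x / 1) · w x) (λ x i → a x × seq (w x) i)
      (λ x i → *≡× (a x) (seq (w x) i)) i (filter (_∈? S) (allFin n)))
    (combine-χ i S a)

  sumOver≡⟦χ⟧ : ∀ S i → seq (sumOver S w) i ≡ ⟦ χ S ⟧ i
  sumOver≡⟦χ⟧ S i = trans
    (seq-foldr w (λ x i → 1 × seq (w x) i)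
      (λ x i → sym (ℚ.+-identityʳ (seq (w x) i))) i (filter (_∈? S) (allFin n)))
    (trans (combine-χ i S (λ _ → 1)) (combine-cong i (λ x → ℕ.*-identityʳ (χ S x))))

  -- The centroid condition, doubled so that no factor 1/2 enters the coefficients.
  ≤½⇒2χ⊑χ : ∀ {S H : Subset n} → sumOver H w ≤ ½ · sumOver S w → χ H ⊕ χ H ⊑ χ S
  ≤½⇒2χ⊑χ {S} {H} h = ⟪
    ≲-trans (≲-reflexive λ i → trans (combine-⊕ i (χ H) (χ H))
      (cong₂ ℚ._+_ {x = ⟦ χ H ⟧ i} {u = ⟦ χ H ⟧ i} (sym (sumOver≡⟦χ⟧ H i)) (sym (sumOver≡⟦χ⟧ H i))))
    (≲-trans (∔-mono {sH} {½sS} {sH} {½sS} (eventually h) (eventually h))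
      (≲-reflexive λ i → trans (half+half (seq (sumOver S w) i)) (sumOver≡⟦χ⟧ S i))) ⟫
    where
    sH ½sS : ℕ → ℚ
    sH  = seq (sumOver H w)
    ½sS = seq (½ · sumOver S w)

  module _ (w≥0 : ∀ x → 0ℝ ≤ w x) where

    -- `b` is `a` plus a natural difference, whose combination of nonnegative weights is
    -- nonnegative. This is where `w≥0` enters.
    ≤⇒⊑ : ∀ {a b} → (∀ x → a x ℕ.≤ b x) → a ⊑ b
    ≤⇒⊑ {a} {b} a≤b = ⟪
      ≲-trans (≲-reflexive λ i → sym (ℚ.+-identityʳ (⟦ a ⟧ i)))
      (≲-trans (∔-mono {⟦ a ⟧} {⟦ a ⟧} {λ _ → 0ℚ} {⟦ d ⟧} (≲-reflexive λ _ → refl)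
        (sum-nonNeg (λ x i → d x × seq (w x) i) λ x → ×-nonNeg (d x) (eventually (w≥0 x))))
      (≲-reflexive λ i → trans (sym (combine-⊕ i a d)) (combine-cong i (λ x → ℕ.m+[n∸m]≡n (a≤b x))))) ⟫
      where
      d : Fin n → ℕ
      d x = b x ℕ.∸ a x

    ⊑-refl : ∀ {a} → a ⊑ a
    ⊑-refl = ≤⇒⊑ λ _ → ℕ.≤-refl

    ⊙-monoʳ : ∀ k {a b} → a ⊑ b → k ⊙ a ⊑ k ⊙ b
    ⊙-monoʳ zero    a⊑b = ≤⇒⊑ λ _ → z≤n
    ⊙-monoʳ (suc k) a⊑b = ⊕-mono a⊑b (⊙-monoʳ k a⊑b)

-- Walks and components

open import Relation.Binary.Construct.Closure.ReflexiveTransitive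
  using (Star; ε; _◅_; _◅◅_; gmap; reverse)

x∈p─q⇒x∉q : ∀ {n} (p q : Subset n) {x} → x ∈ p ─ q → x ∉ q
x∈p─q⇒x∉q (_ ∷ p) (outside ∷ q) (there x∈p─q) (there x∈q) = x∈p─q⇒x∉q p q x∈p─q x∈q
x∈p─q⇒x∉q (_ ∷ p) (inside  ∷ q) (there x∈p─q) (there x∈q) = x∈p─q⇒x∉q p q x∈p─q x∈q

x∈p-y⇒x≢y : ∀ {n} (p : Subset n) {x y} → x ∈ p - y → x ≢ y
x∈p-y⇒x≢y p {y = y} x∈p-y refl = x∈p─q⇒x∉q p ⁅ y ⁆ x∈p-y (x∈⁅x⁆ y)

module _ {n} {P : Fin n → Set} (P? : Decidable P) where

  satisfying : Subset n
  satisfying = Vec.tabulate (does ∘ P?)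

  ∈-satisfying⁺ : ∀ {x} → P x → x ∈ satisfying
  ∈-satisfying⁺ {x} Px = lookup⇒[]= x satisfying
    (trans (lookup∘tabulate (does ∘ P?) x) (dec-true (P? x) Px))

  ∈-satisfying⁻ : ∀ {x} → x ∈ satisfying → P x
  ∈-satisfying⁻ {x} x∈ with P? x | trans (sym (lookup∘tabulate (does ∘ P?) x)) ([]=⇒lookup x∈)
  ... | yes Px | _ = Px

-- Excluded middle holds under double negation at each point, and finitely many double negations
-- combine into one.
¬¬-decidable : ∀ {n} (P : Fin n → Set) → ¬ ¬ (Decidable P)
¬¬-decidable P = sequence (RawMonad.rawApplicative ¬¬-Monad) (λ x → ¬¬-excluded-middle {A = P x})

module Graphs {n} (G : Graph n) where

  open Graph G

  Walk : Subset n → Fin n → Fin n → Set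
  Walk S = Star (AdjIn G S)

  walk-mono : ∀ {S S′ x y} → S ⊆ S′ → Walk S x y → Walk S′ x y
  walk-mono S⊆S′ = gmap id λ (e , x∈S , y∈S) → e , S⊆S′ x∈S , S⊆S′ y∈S

  walk-sym : ∀ {S x y} → Walk S x y → Walk S y x
  walk-sym = reverse λ (e , x∈S , y∈S) → symm e , y∈S , x∈S

  walk-end : ∀ {S x y} → x ∈ S → Walk S x y → y ∈ S
  walk-end x∈S ε                    = x∈S
  walk-end x∈S ((_ , _ , y∈S) ◅ ys) = walk-end y∈S ys

  connected-from : ∀ {S x} → x ∈ S → (∀ {y} → y ∈ S → Walk S x y) → Connected G S
  connected-from x∈S walks = (_ , x∈S) , λ u∈S v∈S → walk-sym (walks u∈S) ◅◅ walks v∈S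

  -- `H ∪ K` is connected through the common vertex `x`, so maximality of `H` applies to it.
  component-absorbs : ∀ {S H K x} → IsComponent G S H → Connected G K → K ⊆ S →
                      x ∈ H → x ∈ K → K ⊆ H
  component-absorbs {S} {H} {K} {x} (H⊆S , (_ , H-walk) , maximal) (_ , K-walk) K⊆S x∈H x∈K y∈K =
    maximal (H ∪ K) (p⊆p∪q K) H∪K⊆S (connected-from (x∈p∪q⁺ (inj₁ x∈H)) walks) (x∈p∪q⁺ (inj₂ y∈K))
    where
    H∪K⊆S : H ∪ K ⊆ S
    H∪K⊆S y∈H∪K with x∈p∪q⁻ H K y∈H∪K
    ... | inj₁ y∈H = H⊆S y∈H
    ... | inj₂ y∈K = K⊆S y∈K

    walks : ∀ {y} → y ∈ H ∪ K → Walk (H ∪ K) x y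
    walks y∈H∪K with x∈p∪q⁻ H K y∈H∪K
    ... | inj₁ y∈H = walk-mono (p⊆p∪q K) (H-walk x∈H y∈H)
    ... | inj₂ y∈K = walk-mono (q⊆p∪q H K) (K-walk x∈K y∈K)

  components-agree : ∀ {S H H′ x} → IsComponent G S H → IsComponent G S H′ →
                     x ∈ H → x ∈ H′ → H ≡ H′
  components-agree c@(H⊆S , con , _) c′@(H′⊆S , con′ , _) x∈H x∈H′ = ⊆-antisym
    (component-absorbs c′ con H⊆S x∈H′ x∈H)
    (component-absorbs c con′ H′⊆S x∈H x∈H′)

  -- The pair of `x` and `y` is connected and meets `H`, hence is absorbed.
  component-adj : ∀ {S H x y} → IsComponent G S H → Adj x y → x ∈ H → y ∈ S → y ∈ H
  component-adj {S} {H} {x} {y} c@(H⊆S , _ , _) xy x∈H y∈S =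
    component-absorbs c (connected-from x∈K walks) K⊆S x∈H x∈K y∈K
    where
    K : Subset n
    K = ⁅ x ⁆ ∪ ⁅ y ⁆

    x∈K : x ∈ K
    x∈K = x∈p∪q⁺ (inj₁ (x∈⁅x⁆ x))

    y∈K : y ∈ K
    y∈K = x∈p∪q⁺ (inj₂ (x∈⁅x⁆ y))

    walks : ∀ {z} → z ∈ K → Walk K x z
    walks z∈K with x∈p∪q⁻ ⁅ x ⁆ ⁅ y ⁆ z∈K
    ... | inj₁ z∈x rewrite x∈⁅y⁆⇒x≡y x z∈x = ε
    ... | inj₂ z∈y rewrite x∈⁅y⁆⇒x≡y y z∈y = (xy , x∈K , y∈K) ◅ ε

    K⊆S : K ⊆ S
    K⊆S z∈K with x∈p∪q⁻ ⁅ x ⁆ ⁅ y ⁆ z∈K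
    ... | inj₁ z∈x rewrite x∈⁅y⁆⇒x≡y x z∈x = H⊆S x∈H
    ... | inj₂ z∈y rewrite x∈⁅y⁆⇒x≡y y z∈y = y∈S

  -- Reachability is not decided here: only decidable consequences are drawn
  -- from the existence of this component, so its double negation suffices.

  ¬¬-component : ∀ {S u} → u ∈ S →
                 ¬ ¬ (∃ λ H → IsComponent G S H ∧ (∀ {x} → Walk S u x → x ∈ H))
  ¬¬-component {S} {u} u∈S = ¬¬-map build (¬¬-decidable (Walk S u))
    where
    build : Decidable (Walk S u) → ∃ λ H → IsComponent G S H ∧ (∀ {x} → Walk S u x → x ∈ H)
    build walk? = H , (H⊆S , connected-from (∈⁺ ε) (λ x∈H → within ε (∈⁻ x∈H)) , maximal) , ∈⁺
      where
      H : Subset n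
      H = satisfying walk?

      ∈⁺ : ∀ {x} → Walk S u x → x ∈ H
      ∈⁺ = ∈-satisfying⁺ walk?

      ∈⁻ : ∀ {x} → x ∈ H → Walk S u x
      ∈⁻ = ∈-satisfying⁻ walk?

      H⊆S : H ⊆ S
      H⊆S x∈H = walk-end u∈S (∈⁻ x∈H)

      within : ∀ {x y} → Walk S u x → Walk S x y → Walk H x y
      within ux ε                          = ε
      within ux (e@(xz , x∈S , z∈S) ◅ zy) = (xz , ∈⁺ ux , ∈⁺ uz) ◅ within uz zy
        where uz = ux ◅◅ e ◅ ε

      maximal : ∀ K → H ⊆ K → K ⊆ S → Connected G K → K ⊆ H
      maximal K H⊆K K⊆S (_ , K-walk) x∈K = ∈⁺ (walk-mono K⊆S (K-walk (H⊆K (∈⁺ ε)) x∈K))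

  -- The last vertex of a walk to r before its first visit of r.

  walk-to-neighbour : ∀ {S x r} → x ∈ S → x ≢ r → Walk S x r →
                      ∃ λ u → Adj r u ∧ Walk (S - r) x u
  walk-to-neighbour x∈S x≢r ε = contradiction refl x≢r
  walk-to-neighbour {r = r} x∈S x≢r (_◅_ {j = y} (xy , _ , y∈S) yr) with y ≟ r
  ... | yes refl = _ , symm xy , ε
  ... | no y≢r   =
    let u , ru , yu = walk-to-neighbour y∈S y≢r yr
    in u , ru , (xy , x∈p∧x≢y⇒x∈p-y x∈S x≢r , x∈p∧x≢y⇒x∈p-y y∈S y≢r) ◅ yu

-- Search trees

∣⁅x⁆∪p∣≤1+∣p∣ : ∀ {n} (x : Fin n) (p : Subset n) → ∣ ⁅ x ⁆ ∪ p ∣ ℕ.≤ suc ∣ p ∣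
∣⁅x⁆∪p∣≤1+∣p∣ zero    (s ∷ p)       rewrite ∪-identityˡ p = s≤s (∣p∣≤∣x∷p∣ s p)
∣⁅x⁆∪p∣≤1+∣p∣ (suc x) (inside ∷ p)  = s≤s (∣⁅x⁆∪p∣≤1+∣p∣ x p)
∣⁅x⁆∪p∣≤1+∣p∣ (suc x) (outside ∷ p) = ∣⁅x⁆∪p∣≤1+∣p∣ x p

module Trees {n} (G : Graph n) where

  open Graphs G

  -- The path from the root to `x`, with `x` included, by the recursion of `depth`; like `depth`, it
  -- is meaningful only for vertices of the tree.
  ancestors : ∀ {S} → SearchTree G S → Fin n → Subset n
  ancestorsIn : ∀ {Hs} → All (SearchTree G) Hs → Fin n → Subset n

  ancestors (node r _ _ _ _ Ts) x = ⁅ r ⁆ ∪ (if does (x ≟ r) then ⊥ else ancestorsIn Ts x)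

  ancestorsIn []                 x = ⊥
  ancestorsIn (_∷_ {x = H} T Ts) x = if does (x ∈? H) then ancestors T x else ancestorsIn Ts x

  -- Turns ancestor counts into lower bounds on the cost of `T`.
  ∣ancestors∣≤depth : ∀ {S} (T : SearchTree G S) x → ∣ ancestors T x ∣ ℕ.≤ depth G T x
  ∣ancestorsIn∣≤depths : ∀ {Hs} (Ts : All (SearchTree G) Hs) x → ∣ ancestorsIn Ts x ∣ ℕ.≤ depths G Ts x

  ∣ancestors∣≤depth (node r _ _ _ _ Ts) x with does (x ≟ r)
  ... | true  = ℕ.≤-trans (∣⁅x⁆∪p∣≤1+∣p∣ r ⊥) (s≤s (ℕ.≤-reflexive (∣⊥∣≡0 n)))
  ... | false = ℕ.≤-trans (∣⁅x⁆∪p∣≤1+∣p∣ r (ancestorsIn Ts x)) (s≤s (∣ancestorsIn∣≤depths Ts x))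

  ∣ancestorsIn∣≤depths []                 x = ℕ.≤-reflexive (∣⊥∣≡0 n)
  ∣ancestorsIn∣≤depths (_∷_ {x = H} T Ts) x with does (x ∈? H)
  ... | true  = ∣ancestors∣≤depth T x
  ... | false = ∣ancestorsIn∣≤depths Ts x

  -- `t` is the root of the restriction of `T` to `K`. If the root `r` of `T` is outside `K`, then
  -- `K` is connected in `S - r`, lies in a single component, and the search continues in that
  -- child.
  top : ∀ {S} (T : SearchTree G S) {K} → Connected G K → K ⊆ S →
        ∃ λ t → t ∈ K ∧ (∀ {x} → x ∈ K → t ∈ ancestors T x)
  topIn : ∀ {S Hs} (Ts : All (SearchTree G) Hs) → (∀ {H} → H List.∈ Hs → IsComponent G S H) →
          ∀ {K} → Connected G K → K ⊆ S → Any (K ⊆_) Hs →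
          ∃ λ t → t ∈ K ∧ (∀ {x} → x ∈ K → t ∈ ancestorsIn Ts x)

  top {S} (node r _ Hs _ comps Ts) {K} con@((u , u∈K) , K-walk) K⊆S with r ∈? K
  ... | yes r∈K = r , r∈K , λ _ → x∈p∪q⁺ (inj₁ (x∈⁅x⁆ r))
  ... | no  r∉K = t , t∈K , above
    where
    K⊆S-r : K ⊆ S - r
    K⊆S-r x∈K = x∈p∧x≢y⇒x∈p-y (K⊆S x∈K) λ { refl → r∉K x∈K }

    -- Inclusion in a listed subset is decidable, so the doubly negated existence of the component
    -- suffices.
    home : Any (K ⊆_) Hs
    home = decidable-stable (Any.any? (K ⊆?_) Hs)
      (¬¬-map (λ (H , comp , reach) → List.lose (Equivalence.from (comps H) comp)
                λ {x} x∈K → reach (walk-mono K⊆S-r (K-walk u∈K x∈K)))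
        (¬¬-component (K⊆S-r u∈K)))

    inner : ∃ λ t → t ∈ K ∧ (∀ {x} → x ∈ K → t ∈ ancestorsIn Ts x)
    inner = topIn Ts (λ {H} → Equivalence.to (comps H)) con K⊆S-r home
    t = proj₁ inner
    t∈K = proj₁ (proj₂ inner)

    above : ∀ {x} → x ∈ K → t ∈ ⁅ r ⁆ ∪ (if does (x ≟ r) then ⊥ else ancestorsIn Ts x)
    above {x} x∈K with x ≟ r
    ... | yes refl = contradiction x∈K r∉K
    ... | no  _    = x∈p∪q⁺ (inj₂ (proj₂ (proj₂ inner) x∈K))

  topIn (_∷_ {x = H} T Ts) comps {K} con K⊆S home with K ⊆? H
  ... | yes K⊆H = t , t∈K , above
    where
    t = proj₁ (top T con K⊆H)
    t∈K = proj₁ (proj₂ (top T con K⊆H))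
    above : ∀ {x} → x ∈ K → t ∈ (if does (x ∈? H) then ancestors T x else ancestorsIn Ts x)
    above {x} x∈K with x ∈? H
    ... | yes _  = proj₂ (proj₂ (top T con K⊆H)) x∈K
    ... | no x∉H = contradiction (K⊆H x∈K) x∉H
  ... | no  K⊈H = t , proj₁ (proj₂ inner) , above
    where
    inner : ∃ λ t → t ∈ K ∧ (∀ {x} → x ∈ K → t ∈ ancestorsIn Ts x)
    inner = topIn Ts (comps ∘ there) con K⊆S (Any.tail (λ K⊆H → K⊈H λ {x} → K⊆H {x}) home)
    t = proj₁ inner
    above : ∀ {x} → x ∈ K → t ∈ (if does (x ∈? H) then ancestors T x else ancestorsIn Ts x)
    above {x} x∈K with x ∈? H
    -- A single common vertex would force all of `K` into `H`.
    ... | yes x∈H = contradiction (λ {x} → component-absorbs (comps (here refl)) con K⊆S x∈H x∈K {x}) K⊈H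
    ... | no  _   = proj₂ (proj₂ inner) x∈K

  sumAll : (∀ {H} → SearchTree G H → ℕ) → ∀ {Hs} → All (SearchTree G) Hs → ℕ
  sumAll f []       = 0
  sumAll f (T ∷ Ts) = f T ℕ.+ sumAll f Ts

  sumAll-zero : (f : ∀ {H} → SearchTree G H → ℕ) → ∀ {Hs} (Ts : All (SearchTree G) Hs) →
                (∀ {H} (m : H List.∈ Hs) → f (All.lookup Ts m) ≡ 0) → sumAll f Ts ≡ 0
  sumAll-zero f []       zeros = refl
  sumAll-zero f (T ∷ Ts) zeros = cong₂ ℕ._+_ (zeros (here refl)) (sumAll-zero f Ts (zeros ∘ there))

  -- Children are disjoint, so only the child holding `r` (for the spine) or `x` (for the frontier)
  -- contributes, and `Unique` lets it count once.
  sumAll-single : (f : ∀ {H} → SearchTree G H → ℕ) → ∀ {Hs} (Ts : All (SearchTree G) Hs) → Unique Hs →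
                  ∀ {H} (m : H List.∈ Hs) →
                  (∀ {H′} (m′ : H′ List.∈ Hs) → H′ ≢ H → f (All.lookup Ts m′) ≡ 0) →
                  sumAll f Ts ≡ f (All.lookup Ts m)
  sumAll-single f (T ∷ Ts) (fresh ∷ _) (here refl) zeros = trans
    (cong (f T ℕ.+_) (sumAll-zero f Ts λ m′ → zeros (there m′) (≢-sym (All.lookup fresh m′))))
    (ℕ.+-identityʳ (f T))
  sumAll-single f (T ∷ Ts) (fresh ∷ uniq) (there m) zeros = cong₂ ℕ._+_
    (zeros (here refl) (All.lookup fresh m))
    (sumAll-single f Ts uniq m (zeros ∘ there))

-- Ancestor counts and the path towards a vertex

module Costs {n} (G : Graph n) (up : Fin n → Subset n) where

  open Graphs G
  open Trees G

  cnt : Subset n → Fin n → ℕ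
  cnt S x = ∣ up x ∩ S ∣

  -- Coefficients of the cost of the restriction to `S` of the search tree behind `up`.
  own : Subset n → Fin n → ℕ
  own S x = χ S x ℕ.* cnt S x

  cnt-mono : ∀ {H S} → H ⊆ S → ∀ x → cnt H x ℕ.≤ cnt S x
  cnt-mono {H} H⊆S x = p⊆q⇒∣p∣≤∣q∣ λ y∈ →
    let y∈up , y∈H = x∈p∩q⁻ (up x) H y∈ in x∈p∩q⁺ (y∈up , H⊆S y∈H)

  cnt-< : ∀ {H S x y} → H ⊆ S → y ∈ up x → y ∈ S → y ∉ H → cnt H x ℕ.< cnt S x
  cnt-< {H} {S} {x} {y} H⊆S y∈up y∈S y∉H = p⊂q⇒∣p∣<∣q∣
    ( (λ z∈ → let z∈up , z∈H = x∈p∩q⁻ (up x) H z∈ in x∈p∩q⁺ (z∈up , H⊆S z∈H))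
    , y , x∈p∩q⁺ (y∈up , y∈S) , y∉H ∘ proj₂ ∘ x∈p∩q⁻ (up x) H )

  avoid : ∀ {H S : Subset n} {y} → y ∉ H → H ⊆ S → H ⊆ S - y
  avoid y∉H H⊆S z∈H = x∈p∧x≢y⇒x∈p-y (H⊆S z∈H) λ { refl → y∉H z∈H }

  cnt-- : ∀ {S x y} → y ∈ up x → y ∈ S → cnt (S - y) x ℕ.< cnt S x
  cnt-- {S} {x} {y} y∈up y∈S =
    cnt-< (p─q⊆p S ⁅ y ⁆) y∈up y∈S λ y∈S-y → x∈p-y⇒x≢y S y∈S-y refl

  own-∈ : ∀ {S x} → x ∈ S → own S x ≡ cnt S x
  own-∈ {S} {x} x∈S rewrite χ-∈ x∈S = ℕ.+-identityʳ (cnt S x)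

  own-∉ : ∀ {S x} → x ∉ S → own S x ≡ 0
  own-∉ x∉S rewrite χ-∉ x∉S = refl

  -- Follow the path of a search tree towards r for at most k steps: the spine
  -- counts the trees met on the way, and the frontier is the cost that the
  -- ancestors up assign to the parts that are left over.

  module Towards (r : Fin n) where

    spine : ∀ (k : ℕ) {S} → SearchTree G S → Fin n → ℕ
    spineBranch : ℕ → Fin n → ∀ {H} → SearchTree G H → ℕ
    spine zero    T x = 0
    spine (suc k) {S} (node _ _ _ _ _ Ts) x = χ S x ℕ.+ sumAll (spineBranch k x) Ts
    spineBranch k x {H} T = if does (r ∈? H) then spine k T x else 0

    frontier : ∀ (k : ℕ) {S} → SearchTree G S → Fin n → ℕ
    frontierBranch : ℕ → Fin n → ∀ {H} → SearchTree G H → ℕ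
    frontier zero    {S} T x = own S x
    frontier (suc k) {S} (node _ _ _ _ _ Ts) x = sumAll (frontierBranch k x) Ts
    frontierBranch k x {H} T = if does (r ∈? H) then frontier k T x else own H x

    frontier-∉ : ∀ k {S} (T : SearchTree G S) {x} → x ∉ S → frontier k T x ≡ 0
    frontierBranch-∉ : ∀ k {S} (T : SearchTree G S) {x} → x ∉ S → frontierBranch k x T ≡ 0

    frontier-∉ zero    T x∉S = own-∉ x∉S
    frontier-∉ (suc k) {S} (node c _ _ _ comps Ts) x∉S = sumAll-zero _ Ts λ {H} m →
      frontierBranch-∉ k (All.lookup Ts m)
        (x∉S ∘ p─q⊆p S ⁅ c ⁆ ∘ proj₁ (Equivalence.to (comps H) m))

    frontierBranch-∉ k {S} T x∉S with does (r ∈? S)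
    ... | true  = frontier-∉ k T x∉S
    ... | false = own-∉ x∉S

    spineBranch-towards : ∀ k x {H} (T : SearchTree G H) → r ∈ H → spineBranch k x T ≡ spine k T x
    spineBranch-towards k x {H} T r∈H with r ∈? H
    ... | yes _  = refl
    ... | no r∉H = contradiction r∈H r∉H

    spineBranch-aside : ∀ k x {H} (T : SearchTree G H) → r ∉ H → spineBranch k x T ≡ 0
    spineBranch-aside k x {H} T r∉H with r ∈? H
    ... | yes r∈H = contradiction r∈H r∉H
    ... | no _    = refl

    frontierBranch-towards : ∀ k x {H} (T : SearchTree G H) → r ∈ H → frontierBranch k x T ≡ frontier k T x
    frontierBranch-towards k x {H} T r∈H with r ∈? H
    ... | yes _  = refl
    ... | no r∉H = contradiction r∈H r∉H

    frontierBranch-aside : ∀ k x {H} (T : SearchTree G H) → r ∉ H → frontierBranch k x T ≡ own H x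
    frontierBranch-aside k x {H} T r∉H with r ∈? H
    ... | yes r∈H = contradiction r∈H r∉H
    ... | no _    = refl

    module Children {S c} (c∈S : c ∈ S) {Hs : List (Subset n)} (uniq : Unique Hs)
                    (comps : ∀ H → H List.∈ Hs ⇔ IsComponent G (S - c) H)
                    (Ts : All (SearchTree G) Hs) where

      private
        T : SearchTree G S
        T = node c c∈S Hs uniq comps Ts

      child : ∀ {H} → H List.∈ Hs → IsComponent G (S - c) H
      child {H} = Equivalence.to (comps H)

      child-⊆ : ∀ {H} → H List.∈ Hs → H ⊆ S
      child-⊆ m = p─q⊆p S ⁅ c ⁆ ∘ proj₁ (child m)

      spine-towards : ∀ k x {H} (m : H List.∈ Hs) → r ∈ H →
                      sumAll (spineBranch k x) Ts ≡ spine k (All.lookup Ts m) x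
      spine-towards k x m r∈H = trans
        (sumAll-single _ Ts uniq m λ m′ H′≢H → spineBranch-aside k x (All.lookup Ts m′) λ r∈H′ →
          H′≢H (components-agree (child m′) (child m) r∈H′ r∈H))
        (spineBranch-towards k x (All.lookup Ts m) r∈H)

      frontier-child : ∀ k {H x} (m : H List.∈ Hs) → x ∈ H →
                       frontier (suc k) T x ≡ frontierBranch k x (All.lookup Ts m)
      frontier-child k m x∈H = sumAll-single _ Ts uniq m λ m′ H′≢H →
        frontierBranch-∉ k (All.lookup Ts m′) λ x∈H′ →
          H′≢H (components-agree (child m′) (child m) x∈H′ x∈H)

      frontier-towards : ∀ k {H x} (m : H List.∈ Hs) → r ∈ H → x ∈ H →
                         frontier (suc k) T x ≡ frontier k (All.lookup Ts m) x
      frontier-towards k m r∈H x∈H =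
        trans (frontier-child k m x∈H) (frontierBranch-towards k _ (All.lookup Ts m) r∈H)

      -- If `x` lies in no child, for instance as the root `c`, its frontier value is 0; otherwise
      -- its child is left over whole. In use, `D` is `S` without some ancestors of `x`, each of
      -- which is a unit saved.
      frontier-aside : ∀ k {D x} → (∀ {H} → H List.∈ Hs → x ∈ H → r ∉ H ∧ H ⊆ D) →
                       frontier (suc k) T x ℕ.≤ cnt D x
      frontier-aside k {D} {x} aside with Any.any? (x ∈?_) Hs
      ... | no x∉Hs = ℕ.≤-trans (ℕ.≤-reflexive (sumAll-zero _ Ts λ m →
              frontierBranch-∉ k (All.lookup Ts m) (x∉Hs ∘ List.lose m))) z≤n
      ... | yes x∈Hs with H , m , x∈H ← List.find x∈Hs
        with r∉H , H⊆D ← aside m x∈H = begin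
        frontier (suc k) T x                     ≡⟨ frontier-child k m x∈H ⟩
        frontierBranch k x (All.lookup Ts m)     ≡⟨ frontierBranch-aside k x (All.lookup Ts m) r∉H ⟩
        own H x                                  ≡⟨ own-∈ x∈H ⟩
        cnt H x                                  ≤⟨ cnt-mono H⊆D x ⟩
        cnt D x                                  ∎
        where open ℕ.≤-Reasoning

    -- The last index is the subtree reached after k steps, which contains r, or
    -- ⊥ if r was met as a root on the way.

    data Descent : ℕ → ∀ {S} → SearchTree G S → Subset n → Set where
      stop : ∀ {S} {T : SearchTree G S} → Descent 0 T S
      lost : ∀ {k S c c∈S Hs uniq comps Ts} → (∀ {H} → H List.∈ Hs → r ∉ H) →
             Descent (suc k) {S} (node c c∈S Hs uniq comps Ts) ⊥
      down : ∀ {k S S′ c c∈S Hs uniq comps Ts H} (m : H List.∈ Hs) → r ∈ H →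
             Descent k (All.lookup Ts m) S′ →
             Descent (suc k) {S} (node c c∈S Hs uniq comps Ts) S′

    descend : ∀ k {S} (T : SearchTree G S) → ∃ (Descent k T)
    descend zero    {S} T = S , stop
    descend (suc k) (node _ _ Hs _ _ Ts) with Any.any? (r ∈?_) Hs
    ... | no r∉Hs  = ⊥ , lost λ m r∈H → r∉Hs (List.lose m r∈H)
    ... | yes r∈Hs with H , m , r∈H ← List.find r∈Hs
      with S′ , D ← descend k (All.lookup Ts m) = S′ , down m r∈H D

    descent-end : ∀ {k S S′} {T : SearchTree G S} → Descent k T S′ → r ∈ S → S′ ≡ ⊥ ⊎ r ∈ S′
    descent-end stop           r∈S = inj₂ r∈S
    descent-end (lost _)       _   = inj₁ refl
    descent-end (down _ r∈H D) _   = descent-end D r∈H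

    descent-⊆ : ∀ {k S S′} {T : SearchTree G S} → Descent k T S′ → S′ ⊆ S
    descent-⊆ stop     x∈S = x∈S
    descent-⊆ (lost _) x∈⊥ = contradiction x∈⊥ ∉⊥
    descent-⊆ (down {c∈S = c∈S} {uniq = uniq} {comps} {Ts} m _ D) = child-⊆ m ∘ descent-⊆ D
      where open Children c∈S uniq comps Ts

    -- r is an ancestor, outside its part, of every vertex that was left over.

    frontier-gain : ∀ {k S S′} {T : SearchTree G S} → Descent k T S′ → r ∈ S →
                    ∀ {x} → r ∈ up x → x ∈ S → suc (frontier k T x) ℕ.≤ cnt S x ℕ.+ χ S′ x
    frontier-gain {S = S} stop r∈S {x} r∈up x∈S = ℕ.≤-reflexive (begin
      suc (own S x)           ≡⟨ cong suc (own-∈ x∈S) ⟩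
      suc (cnt S x)           ≡⟨ ℕ.+-comm (cnt S x) 1 ⟨
      cnt S x ℕ.+ 1           ≡⟨ cong (cnt S x ℕ.+_) (χ-∈ x∈S) ⟨
      cnt S x ℕ.+ χ S x       ∎)
      where open ≡-Reasoning
    frontier-gain {S = S} (lost {k} {c∈S = c∈S} {uniq = uniq} {comps} {Ts} r∉Hs) r∈S {x} r∈up x∈S =
      ℕ.m≤n⇒m≤n+o _ (ℕ.≤-trans (s≤s (frontier-aside k λ m _ → r∉Hs m , avoid (r∉Hs m) (child-⊆ m)))
        (cnt-- r∈up r∈S))
      where open Children c∈S uniq comps Ts
    frontier-gain {S = S} {S′} (down {k} {c∈S = c∈S} {uniq = uniq} {comps} {Ts} {H} m r∈H D)
                  r∈S {x} r∈up x∈S with x ∈? H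
    ... | yes x∈H = begin
      suc (frontier (suc k) (node _ c∈S _ uniq comps Ts) x)  ≡⟨ cong suc (frontier-towards k m r∈H x∈H) ⟩
      suc (frontier k (All.lookup Ts m) x)                   ≤⟨ frontier-gain D r∈H r∈up x∈H ⟩
      cnt H x ℕ.+ χ S′ x                                     ≤⟨ ℕ.+-monoˡ-≤ (χ S′ x) (cnt-mono (child-⊆ m) x) ⟩
      cnt S x ℕ.+ χ S′ x                                     ∎
      where
      open ℕ.≤-Reasoning
      open Children c∈S uniq comps Ts
    ... | no x∉H = ℕ.m≤n⇒m≤n+o _ (ℕ.≤-trans
      (s≤s (frontier-aside k λ m′ x∈H′ →
        let r∉H′ = λ r∈H′ → x∉H (subst (x ∈_) (components-agree (child m′) (child m) r∈H′ r∈H) x∈H′)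
        in r∉H′ , avoid r∉H′ (child-⊆ m′)))
      (cnt-- r∈up r∈S))
      where open Children c∈S uniq comps Ts

-- Layers between consecutive trees on the path

module Descents {n} (G : Graph n) (up : Fin n → Subset n) (w : Fin n → ℝ) (w≥0 : ∀ x → 0ℝ ≤ w x) where

  open Graph G
  open Graphs G
  open Trees G
  open Costs G up
  open Weighted w

  CentroidTree : ∀ {S} → SearchTree G S → Set
  CentroidTree = IsCentroidTree G w

  module _ {S c} {c∈S : c ∈ S} {Hs : List (Subset n)} {uniq : Unique Hs}
           {comps : ∀ H → H List.∈ Hs ⇔ IsComponent G (S - c) H}
           {Ts : All (SearchTree G) Hs}
           (centroid : CentroidTree (node c c∈S Hs uniq comps Ts))
           {H} (m : H List.∈ Hs) where

    centroid-child : CentroidTree (All.lookup Ts m)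
    centroid-child T′ T′≼T = centroid T′ (below m T′≼T)

    child-light : χ H ⊕ χ H ⊑ χ S
    child-light = ≤½⇒2χ⊑χ (proj₂ (centroid _ here) H (Equivalence.to (comps H) m))

  -- One step S ⊃ H of the descent towards r contributes the layer S ─ H.

  record Layer (r : Fin n) (V S′ : Subset n) (f : Fin n → ℕ) : Set where
    field
      members  : Subset n
      centre   : Fin n
      centre∈V : centre ∈ V
      centre≢r : centre ≢ r
      members⊆ : members ⊆ V
      heavy    : χ S′ ⊑ χ members
      apart    : ∀ {x} → x ∈ members → x ∉ S′
      reach    : ∀ {x} → x ∈ members → Walk (V - r) centre x
      -- The part left over around `x` stays inside the layer, so `r` and `y` are two distinct
      -- ancestors that it misses.
      gain     : ∀ {x y} → x ∈ members → r ∈ up x → y ∈ up x → y ∈ V → y ≢ r → y ∉ members →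
                 2 ℕ.+ f x ℕ.≤ cnt V x

  open Layer

  Disjoint : ∀ {r V S′ f} → Layer r V S′ f → Layer r V S′ f → Set
  Disjoint L L′ = ∀ {x} → x ∈ members L → x ∉ members L′

  module _ {r : Fin n} where

    open Towards r

    module Step {S c} (c∈S : c ∈ S) {Hs : List (Subset n)} (uniq : Unique Hs)
                (comps : ∀ H → H List.∈ Hs ⇔ IsComponent G (S - c) H)
                (Ts : All (SearchTree G) Hs) {H} (m : H List.∈ Hs) (r∈H : r ∈ H)
                {k S′} (D : Descent k (All.lookup Ts m) S′) where

      open Children c∈S uniq comps Ts

      T : SearchTree G S
      T = node c c∈S Hs uniq comps Ts

      f≡ : ∀ {x} → x ∈ H → frontier (suc k) T x ≡ frontier k (All.lookup Ts m) x
      f≡ = frontier-towards k m r∈H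

      S─H : Subset n
      S─H = S ─ H

      ∈─⁻ : ∀ {x} → x ∈ S─H → x ∈ S ∧ x ∉ H
      ∈─⁻ x∈S─H = p─q⊆p S H x∈S─H , x∈p─q⇒x∉q S H x∈S─H

      c≢r : c ≢ r
      c≢r refl = x∈p-y⇒x≢y S (proj₁ (child m) r∈H) refl

      -- A walk to c cannot enter the component H of S - c before meeting c.
      walk-outside : ∀ {x} → x ∉ H → Walk S x c → Walk (S - r) x c
      walk-outside x∉H ε = ε
      walk-outside {x} x∉H (_◅_ {j = y} (xy , x∈S , y∈S) yc) with x ≟ c
      ... | yes refl = ε
      ... | no x≢c   = (xy , minus x∉H x∈S , minus y∉H y∈S) ◅ walk-outside y∉H yc
        where
        minus : ∀ {z} → z ∉ H → z ∈ S → z ∈ S - r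
        minus z∉H z∈S = x∈p∧x≢y⇒x∈p-y z∈S λ { refl → z∉H r∈H }
        y∉H : y ∉ H
        y∉H y∈H = x∉H (component-adj (child m) (symm xy) y∈H (x∈p∧x≢y⇒x∈p-y x∈S x≢c))

      -- For `heavy`: 2 w(H) ≤ w(S) ≤ w(S ─ H) + w(H), so the layer weighs at least as much as `H`,
      -- which contains `S′`.
      outermost : Connected G S → CentroidTree T → Layer r S S′ (frontier (suc k) T)
      outermost (_ , S-walk) centroid = record
        { members  = S─H
        ; centre   = c
        ; centre∈V = c∈S
        ; centre≢r = c≢r
        ; members⊆ = p─q⊆p S H
        ; heavy    = ⊑-trans (≤⇒⊑ w≥0 λ x → χ-mono {S = S′} {H} {x} (descent-⊆ D))
            (⊕-cancelʳ (χ H) (⊑-trans (child-light {Ts = Ts} centroid m)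
              (≤⇒⊑ w≥0 λ x → χ-cover {S = S} {H} {S─H} {x} x∈p∧x∉q⇒x∈p─q)))
        ; apart    = λ x∈ x∈S′ → proj₂ (∈─⁻ x∈) (descent-⊆ D x∈S′)
        ; reach    = λ x∈ → let x∈S , x∉H = ∈─⁻ x∈ in walk-sym (walk-outside x∉H (S-walk x∈S c∈S))
        ; gain     = gain₀
        }
        where
        gain₀ : ∀ {x y} → x ∈ S─H → r ∈ up x → y ∈ up x → y ∈ S → y ≢ r → y ∉ S─H →
                2 ℕ.+ frontier (suc k) T x ℕ.≤ cnt S x
        gain₀ {x} {y} x∈ r∈up y∈up y∈S y≢r y∉ = begin
          -- Both `r` and `y` lie in `H`, while a child around `x` is disjoint from `H`.
          2 ℕ.+ frontier (suc k) T x  ≤⟨ s≤s (s≤s (frontier-aside k λ m′ x∈H′ →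
            let x∉H = proj₂ (∈─⁻ x∈)
                agree : ∀ {z} → z ∈ H → z ∉ _
                agree z∈H z∈H′ = x∉H (subst (x ∈_) (components-agree (child m′) (child m) z∈H′ z∈H) x∈H′)
            in agree r∈H , avoid (agree y∈H) (avoid (agree r∈H) (child-⊆ m′)))) ⟩
          2 ℕ.+ cnt (S - r - y) x     ≤⟨ s≤s (cnt-- y∈up (x∈p∧x≢y⇒x∈p-y y∈S y≢r)) ⟩
          1 ℕ.+ cnt (S - r) x         ≤⟨ cnt-- r∈up (child-⊆ m r∈H) ⟩
          cnt S x                     ∎
          where
          open ℕ.≤-Reasoning
          y∈H : y ∈ H
          y∈H = decidable-stable (y ∈? H) λ y∉H → y∉ (x∈p∧x∉q⇒x∈p─q y∈S y∉H)

      lift : Layer r H S′ (frontier k (All.lookup Ts m)) → Layer r S S′ (frontier (suc k) T)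
      lift L = record
        { members  = members L
        ; centre   = centre L
        ; centre∈V = child-⊆ m (centre∈V L)
        ; centre≢r = centre≢r L
        ; members⊆ = child-⊆ m ∘ members⊆ L
        ; heavy    = heavy L
        ; apart    = apart L
        ; reach    = λ x∈ → walk-mono
            (λ z∈ → x∈p∧x≢y⇒x∈p-y (child-⊆ m (p─q⊆p H ⁅ r ⁆ z∈)) (x∈p-y⇒x≢y H z∈)) (reach L x∈)
        ; gain     = gain₁
        }
        where
        gain₁ : ∀ {x y} → x ∈ members L → r ∈ up x → y ∈ up x → y ∈ S → y ≢ r → y ∉ members L →
                2 ℕ.+ frontier (suc k) T x ℕ.≤ cnt S x
        gain₁ {x} {y} x∈ r∈up y∈up y∈S y≢r y∉ =
          subst (λ e → 2 ℕ.+ e ℕ.≤ cnt S x) (sym (f≡ (members⊆ L x∈))) (by-cases (y ∈? H))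
          where
          open ℕ.≤-Reasoning
          by-cases : Dec (y ∈ H) → 2 ℕ.+ frontier k (All.lookup Ts m) x ℕ.≤ cnt S x
          by-cases (yes y∈H) = ℕ.≤-trans (gain L x∈ r∈up y∈up y∈H y≢r y∉) (cnt-mono (child-⊆ m) x)
          -- One unit is saved for `r` inside `H`, since `x` is outside `S′`; the other for `y`,
          -- which is dropped in passing from `S` to `H`.
          by-cases (no y∉H)  = begin
            2 ℕ.+ frontier k (All.lookup Ts m) x   ≤⟨ s≤s (frontier-gain D r∈H r∈up (members⊆ L x∈)) ⟩
            1 ℕ.+ (cnt H x ℕ.+ χ S′ x)             ≡⟨ cong (λ e → 1 ℕ.+ (cnt H x ℕ.+ e)) (χ-∉ (apart L x∈)) ⟩
            1 ℕ.+ (cnt H x ℕ.+ 0)                  ≡⟨ cong suc (ℕ.+-identityʳ (cnt H x)) ⟩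
            1 ℕ.+ cnt H x                          ≤⟨ cnt-< (child-⊆ m) y∈up y∈S y∉H ⟩
            cnt S x                                ∎

    -- One layer per step. All later layers lie in `H`, so they are disjoint from the first layer
    -- `S ─ H`.
    layers : ∀ {k S S′} {T : SearchTree G S} (D : Descent k T S′) →
             Connected G S → r ∈ S′ → CentroidTree T →
             ∃ λ (L : Fin k → Layer r S S′ (frontier k T)) → ∀ {i j} → i ≢ j → Disjoint (L i) (L j)
    layers stop     _ _   _ = (λ ()) , λ { {()} }
    layers (lost _) _ r∈⊥ _ = contradiction r∈⊥ ∉⊥
    layers {suc k} {S} {S′} (down {c∈S = c∈S} {Hs = Hs} {uniq = uniq} {comps} {Ts} {H} m r∈H D)
           con r∈S′ centroid
      with inner , inner-disjoint ← layers D (proj₁ (proj₂ (Equivalence.to (comps H) m))) r∈S′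
                                      (centroid-child {Ts = Ts} centroid m)
      = L , disjoint
      where
      open Step c∈S uniq comps Ts m r∈H D

      L : Fin (suc k) → Layer r S S′ (frontier (suc k) T)
      L zero    = outermost con centroid
      L (suc i) = lift (inner i)

      disjoint : ∀ {i j} → i ≢ j → Disjoint (L i) (L j)
      disjoint {zero}  {zero}  i≢j    = contradiction refl i≢j
      disjoint {zero}  {suc j} i≢j x∈ = proj₂ (∈─⁻ x∈) ∘ members⊆ (inner j)
      disjoint {suc i} {zero}  i≢j x∈ x∈′ = proj₂ (∈─⁻ x∈′) (members⊆ (inner i) x∈)
      disjoint {suc i} {suc j} i≢j    = inner-disjoint (i≢j ∘ cong suc)

-- The geometric series 1 + 2 + ... + 2^k

spineCoefficient : ℕ → ℕ
spineCoefficient zero    = 1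
spineCoefficient (suc k) = 2 ℕ.^ suc k ℕ.+ spineCoefficient k

1+spineCoefficient : ∀ k → suc (spineCoefficient k) ≡ 2 ℕ.* 2 ℕ.^ k
1+spineCoefficient zero    = refl
1+spineCoefficient (suc k) = begin
  suc (2 ℕ.^ suc k ℕ.+ spineCoefficient k)     ≡⟨ ℕ.+-suc (2 ℕ.^ suc k) (spineCoefficient k) ⟨
  2 ℕ.^ suc k ℕ.+ suc (spineCoefficient k)     ≡⟨ cong (2 ℕ.^ suc k ℕ.+_) (1+spineCoefficient k) ⟩
  2 ℕ.^ suc k ℕ.+ 2 ℕ.^ suc k                  ≡⟨ cong (2 ℕ.^ suc k ℕ.+_) (ℕ.+-identityʳ (2 ℕ.^ suc k)) ⟨
  2 ℕ.* 2 ℕ.^ suc k                            ∎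
  where open ≡-Reasoning

2^≤spineCoefficient : ∀ k → 2 ℕ.^ k ℕ.≤ spineCoefficient k
2^≤spineCoefficient zero    = ℕ.≤-refl
2^≤spineCoefficient (suc k) = ℕ.m≤m+n (2 ℕ.^ suc k) (spineCoefficient k)

-- The inductive estimate

module Bound {n} (G : Graph n) (up : Fin n → Subset n)
             (top : ∀ {K} → Connected G K → ∃ λ t → t ∈ K ∧ (∀ {x} → x ∈ K → t ∈ up x))
             (w : Fin n → ℝ) (w≥0 : ∀ x → 0ℝ ≤ w x)
             (Δ : ℕ) (degree≤Δ : ∀ v → degree G v ℕ.≤ Δ) where

  open Graph G
  open Graphs G
  open Trees G using (sumAll; sumAll-zero; sumAll-single)
  open Costs G up
  open Weighted w
  open Descents G up w w≥0
  open Layer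

  module _ {r : Fin n} where

    open Towards r

    -- The at most k + 1 trees on the path weigh at most w(S), w(S)/2, w(S)/4 and so on, together (2
    -- - 2^-k) w(S); both sides are multiplied by 2^k.
    spine-bound : ∀ k {S} (T : SearchTree G S) → CentroidTree T →
                  2 ℕ.^ k ⊙ spine (suc k) T ⊑ spineCoefficient k ⊙ χ S
    spine-bound k {S} (node c c∈S Hs uniq comps Ts) centroid = by-cases k (Any.any? (r ∈?_) Hs)
      where
      open Children c∈S uniq comps Ts
      open +-*-Solver

      by-cases : ∀ k → Dec (Any (r ∈_) Hs) →
                 2 ℕ.^ k ⊙ spine (suc k) (node c c∈S Hs uniq comps Ts) ⊑ spineCoefficient k ⊙ χ S
      by-cases k (no r∉Hs) = ≤⇒⊑ w≥0 λ x → ℕ.≤-trans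
        (ℕ.≤-reflexive (cong (2 ℕ.^ k ℕ.*_) (trans (cong (χ S x ℕ.+_)
          (sumAll-zero (spineBranch k x) Ts λ m → spineBranch-aside k x (All.lookup Ts m) (r∉Hs ∘ List.lose m)))
          (ℕ.+-identityʳ (χ S x)))))
        (ℕ.*-monoˡ-≤ (χ S x) (2^≤spineCoefficient k))
      by-cases zero (yes r∈Hs) = let H , m , r∈H = List.find r∈Hs in ≤⇒⊑ w≥0 λ x → ℕ.≤-reflexive
        (cong (1 ℕ.*_) (trans (cong (χ S x ℕ.+_) (spine-towards 0 x m r∈H)) (ℕ.+-identityʳ (χ S x))))
      by-cases (suc k) (yes r∈Hs) =
        ⊑-trans (≤⇒⊑ w≥0 λ x → ℕ.≤-reflexive (trans
          (cong (λ e → 2 ℕ.^ suc k ℕ.* (χ S x ℕ.+ e)) (spine-towards (suc k) x m r∈H))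
          (solve 3 (λ N s p → con 2 :* N :* (s :+ p) := con 2 :* N :* s :+ (N :* p :+ N :* p)) refl
            (2 ℕ.^ k) (χ S x) (spine (suc k) (All.lookup Ts m) x))))
        (⊑-trans (⊕-mono {a = 2 ℕ.^ suc k ⊙ χ S} (⊑-refl w≥0) (⊕-mono ih ih))
        (⊑-trans (≤⇒⊑ w≥0 λ x → ℕ.≤-reflexive
          (cong (2 ℕ.^ suc k ℕ.* χ S x ℕ.+_) (sym (ℕ.*-distribˡ-+ d (χ H x) (χ H x)))))
        -- The induction hypothesis was doubled to match the power of two; 2 w(H) ≤ w(S) pays for
        -- this.
        (⊑-trans (⊕-mono {a = 2 ℕ.^ suc k ⊙ χ S} {c = d ⊙ (χ H ⊕ χ H)} (⊑-refl w≥0)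
          (⊙-monoʳ w≥0 d (child-light {Ts = Ts} centroid m)))
        (≤⇒⊑ w≥0 λ x → ℕ.≤-reflexive (sym (ℕ.*-distribʳ-+ (χ S x) (2 ℕ.^ suc k) d))))))
        where
        H : Subset n
        H = proj₁ (List.find r∈Hs)
        m : H List.∈ Hs
        m = proj₁ (proj₂ (List.find r∈Hs))
        r∈H : r ∈ H
        r∈H = proj₂ (proj₂ (List.find r∈Hs))
        d : ℕ
        d = spineCoefficient k
        ih : 2 ℕ.^ k ⊙ spine (suc k) (All.lookup Ts m) ⊑ d ⊙ χ H
        ih = spine-bound k (All.lookup Ts m) (centroid-child {Ts = Ts} centroid m)

    -- Every layer meets the component of some neighbour of r in V - r, so two
    -- of more than degree r layers share one; its top lies outside one of them.

    crowded : ∀ {k V S′ f} → Connected G V → r ∈ V → degree G r ℕ.< k →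
              (L : Fin k → Layer r V S′ f) → (∀ {i j} → i ≢ j → Disjoint (L i) (L j)) →
              ∃ λ i → ∃ λ t → t ∈ V ∧ t ≢ r ∧ t ∉ members (L i) ∧ (∀ x → x ∈ members (L i) → t ∈ up x)
    crowded {k} {V} (_ , V-walk) r∈V deg< L disjoint = choose (t ∈? members (L i))
      where
      exit : ∀ i → ∃ λ u → Adj r u ∧ Walk (V - r) (centre (L i)) u
      exit i = walk-to-neighbour (centre∈V (L i)) (centre≢r (L i)) (V-walk (centre∈V (L i)) r∈V)

      neighbours : List (Fin n)
      neighbours = filter (adj? r) (allFin n)

      ∈neighbours : ∀ i → proj₁ (exit i) List.∈ neighbours
      ∈neighbours i = ∈-filter⁺ (adj? r) (∈-allFin _) (proj₁ (proj₂ (exit i)))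

      collision : ∃ λ (i : Fin k) → ∃ λ (j : Fin k) → toℕ i ℕ.< toℕ j ∧
                  Any.index (∈neighbours i) ≡ Any.index (∈neighbours j)
      collision = pigeonhole deg< (λ i → Any.index (∈neighbours i))

      i j : Fin k
      i = proj₁ collision
      j = proj₁ (proj₂ collision)

      i≢j : i ≢ j
      i≢j = Fin.<⇒≢ (proj₁ (proj₂ (proj₂ collision)))

      same-exit : proj₁ (exit i) ≡ proj₁ (exit j)
      same-exit = trans (lookup-index (∈neighbours i))
        (trans (cong (lookup neighbours) (proj₂ (proj₂ (proj₂ collision)))) (sym (lookup-index (∈neighbours j))))

      meet : Walk (V - r) (centre (L i)) (centre (L j))
      meet = proj₂ (proj₂ (exit i)) ◅◅
        subst (λ u → Walk (V - r) u (centre (L j))) (sym same-exit) (walk-sym (proj₂ (proj₂ (exit j))))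

      Above : Fin n → Fin k → Set
      Above t i = ∀ x → x ∈ members (L i) → t ∈ up x

      above? : ∀ t i → Dec (Above t i)
      above? t i = all? λ x → (x ∈? members (L i)) →-dec (t ∈? up x)

      -- `t` is the top of the component containing both layers. Its properties are decidable, so a
      -- finite search removes the double negation.
      common : ∃ λ t → t ∈ V - r ∧ Above t i ∧ Above t j
      common = decidable-stable
        (any? λ t → (t ∈? (V - r)) ×-dec (above? t i ×-dec above? t j))
        (¬¬-map (λ (H , (H⊆ , con , _) , ∈H) → let t , t∈H , t-above = top con in
            t , H⊆ t∈H , (λ x x∈ → t-above (∈H (reach (L i) x∈)))
                       , (λ x x∈ → t-above (∈H (meet ◅◅ reach (L j) x∈))))
          (¬¬-component (x∈p∧x≢y⇒x∈p-y (centre∈V (L i)) (centre≢r (L i)))))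

      t : Fin n
      t = proj₁ common

      t∈V-r : t ∈ V - r
      t∈V-r = proj₁ (proj₂ common)

      choose : Dec (t ∈ members (L i)) →
               ∃ λ i → ∃ λ t → t ∈ V ∧ t ≢ r ∧ t ∉ members (L i) ∧ Above t i
      choose (no t∉)  = i , t , p─q⊆p V ⁅ r ⁆ t∈V-r , x∈p-y⇒x≢y V t∈V-r , t∉ , proj₁ (proj₂ (proj₂ common))
      choose (yes t∈) = j , t , p─q⊆p V ⁅ r ⁆ t∈V-r , x∈p-y⇒x≢y V t∈V-r , disjoint i≢j t∈ , proj₂ (proj₂ (proj₂ common))

    -- No part left over contains `r`, an ancestor of every vertex of `S`; each vertex therefore
    -- saves a unit.
    frontier-lost : ∀ {k S} {T : SearchTree G S} → Descent k T ⊥ → r ∈ S → (∀ {x} → x ∈ S → r ∈ up x) →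
                    frontier k T ⊕ χ S ⊑ own S
    frontier-lost {k} {S} {T} D r∈S r∈up = ≤⇒⊑ w≥0 λ x → by-cases x (x ∈? S)
      where
      open ℕ.≤-Reasoning
      by-cases : ∀ x → Dec (x ∈ S) → frontier k T x ℕ.+ χ S x ℕ.≤ own S x
      by-cases x (no x∉S) = ℕ.≤-trans
        (ℕ.≤-reflexive (cong₂ ℕ._+_ (frontier-∉ k T x∉S) (χ-∉ x∉S))) z≤n
      by-cases x (yes x∈S) = begin
        frontier k T x ℕ.+ χ S x   ≡⟨ cong (frontier k T x ℕ.+_) (χ-∈ x∈S) ⟩
        frontier k T x ℕ.+ 1       ≡⟨ ℕ.+-comm (frontier k T x) 1 ⟩
        suc (frontier k T x)       ≤⟨ frontier-gain D r∈S (r∈up x∈S) x∈S ⟩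
        cnt S x ℕ.+ χ ⊥ x          ≡⟨ cong (cnt S x ℕ.+_) (χ-∉ {S = ⊥} {x} ∉⊥) ⟩
        cnt S x ℕ.+ 0              ≡⟨ ℕ.+-identityʳ (cnt S x) ⟩
        cnt S x                    ≡⟨ own-∈ x∈S ⟨
        own S x                    ∎

    -- The vertices of `S′` may save nothing, but those of the layer save two units, for `r` and
    -- `t`. Pointwise this leaves a deficit `χ S′` against a surplus `χ M`; `heavy` exchanges one
    -- for the other, and `χ M` cancels.
    frontier-layered : ∀ {k S S′ t} {T : SearchTree G S} → Descent k T S′ → r ∈ S → (∀ {x} → x ∈ S → r ∈ up x) →
                       (L : Layer r S S′ (frontier k T)) → t ∈ S → t ≢ r → t ∉ members L →
                       (∀ x → x ∈ members L → t ∈ up x) → frontier k T ⊕ χ S ⊑ own S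
    frontier-layered {k} {S} {S′} {t} {T} D r∈S r∈up L t∈S t≢r t∉ t-above =
      ⊕-cancelʳ (χ M) (⊑-trans (≤⇒⊑ w≥0 λ x → by-cases x (x ∈? S) (x ∈? M))
        (⊕-mono {a = own S} (⊑-refl w≥0) (heavy L)))
      where
      open ℕ.≤-Reasoning
      M : Subset n
      M = members L

      f : Fin n → ℕ
      f = frontier k T

      by-cases : ∀ x → Dec (x ∈ S) → Dec (x ∈ M) → f x ℕ.+ χ S x ℕ.+ χ M x ℕ.≤ own S x ℕ.+ χ S′ x
      by-cases x (no x∉S) _ = ℕ.≤-trans
        (ℕ.≤-reflexive (cong₂ ℕ._+_ (cong₂ ℕ._+_ (frontier-∉ k T x∉S) (χ-∉ x∉S))
          (χ-∉ (x∉S ∘ members⊆ L)))) z≤n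
      by-cases x (yes x∈S) (yes x∈M) = begin
        f x ℕ.+ χ S x ℕ.+ χ M x   ≡⟨ cong₂ (λ a b → f x ℕ.+ a ℕ.+ b) (χ-∈ x∈S) (χ-∈ x∈M) ⟩
        f x ℕ.+ 1 ℕ.+ 1           ≡⟨ ℕ.+-assoc (f x) 1 1 ⟩
        f x ℕ.+ 2                 ≡⟨ ℕ.+-comm (f x) 2 ⟩
        2 ℕ.+ f x                 ≤⟨ gain L x∈M (r∈up x∈S) (t-above x x∈M) t∈S t≢r t∉ ⟩
        cnt S x                   ≡⟨ own-∈ x∈S ⟨
        own S x                   ≤⟨ ℕ.m≤m+n (own S x) (χ S′ x) ⟩
        own S x ℕ.+ χ S′ x        ∎
      by-cases x (yes x∈S) (no x∉M) = begin
        f x ℕ.+ χ S x ℕ.+ χ M x   ≡⟨ cong₂ (λ a b → f x ℕ.+ a ℕ.+ b) (χ-∈ x∈S) (χ-∉ x∉M) ⟩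
        f x ℕ.+ 1 ℕ.+ 0           ≡⟨ ℕ.+-identityʳ (f x ℕ.+ 1) ⟩
        f x ℕ.+ 1                 ≡⟨ ℕ.+-comm (f x) 1 ⟩
        suc (f x)                 ≤⟨ frontier-gain D r∈S (r∈up x∈S) x∈S ⟩
        cnt S x ℕ.+ χ S′ x        ≡⟨ cong (ℕ._+ χ S′ x) (own-∈ x∈S) ⟨
        own S x ℕ.+ χ S′ x        ∎

    frontier-bound : ∀ {S} (T : SearchTree G S) → Connected G S → CentroidTree T →
                     r ∈ S → (∀ {x} → x ∈ S → r ∈ up x) →
                     frontier (suc Δ) T ⊕ χ S ⊑ own S
    frontier-bound {S} T con centroid r∈S r∈up = conclude (descend (suc Δ) T)
      where
      f : Fin n → ℕ
      f = frontier (suc Δ) T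

      conclude : ∃ (Descent (suc Δ) T) → f ⊕ χ S ⊑ own S
      conclude (S′ , D) = by-end (descent-end D r∈S)
        where
        by-end : S′ ≡ ⊥ ⊎ r ∈ S′ → f ⊕ χ S ⊑ own S
        by-end (inj₁ refl) = frontier-lost D r∈S r∈up
        by-end (inj₂ r∈S′) =
          let L , disjoint = layers D con r∈S′ centroid
              -- The descent makes `suc Δ` steps precisely so that the layers outnumber the
              -- neighbours of `r`.
              i , t , t∈S , t≢r , t∉ , t-above = crowded con r∈S (s≤s (degree≤Δ r)) L disjoint
          in frontier-layered D r∈S r∈up (L i) t∈S t≢r t∉ t-above

  depthIn : Fin n → ∀ {S} → SearchTree G S → ℕ
  depthIn x {S} T = χ S x ℕ.* depth G T x

  depths≤ : ∀ {Hs} (Ts : All (SearchTree G) Hs) x → depths G Ts x ℕ.≤ sumAll (depthIn x) Ts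
  depths≤ []                 x = z≤n
  depths≤ (_∷_ {x = H} T Ts) x with does (x ∈? H)
  ... | true  = ℕ.≤-trans (ℕ.≤-reflexive (sym (ℕ.+-identityʳ (depth G T x)))) (ℕ.m≤m+n _ _)
  ... | false = depths≤ Ts x

  depthIn-node : ∀ {S c} (c∈S : c ∈ S) {Hs} (uniq : Unique Hs)
                     (comps : ∀ H → H List.∈ Hs ⇔ IsComponent G (S - c) H) Ts x →
                     depthIn x (node c c∈S Hs uniq comps Ts) ℕ.≤ χ S x ℕ.+ sumAll (depthIn x) Ts
  depthIn-node {S} {c} _ _ _ Ts x with does (x ∈? S) | does (x ≟ c)
  ... | false | _     = z≤n
  ... | true  | true  = s≤s z≤n
  ... | true  | false = s≤s (ℕ.≤-trans (ℕ.≤-reflexive (ℕ.+-identityʳ (depths G Ts x))) (depths≤ Ts x))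

  private
    N D : ℕ
    N = 2 ℕ.^ Δ
    D = spineCoefficient Δ

  -- The spine costs at most D / N times w(S), the frontier at most D / N times its own restricted
  -- cost by induction, and `frontier-bound` adds the two up to `own S`.
  depthIn-bound : ∀ {S} (T : SearchTree G S) → Connected G S → CentroidTree T →
                      N ⊙ (λ x → depthIn x T) ⊑ D ⊙ own S

  path-bound : ∀ r k {S} (T : SearchTree G S) → Connected G S → CentroidTree T →
               N ⊙ (λ x → depthIn x T) ⊑ N ⊙ Towards.spine r k T ⊕ D ⊙ Towards.frontier r k T

  branches-bound : ∀ r k {Hs} (Ts : All (SearchTree G) Hs) →
                   (∀ {H} → H List.∈ Hs → Connected G H) →
                   (∀ {H} (m : H List.∈ Hs) → CentroidTree (All.lookup Ts m)) →
                   N ⊙ (λ x → sumAll (depthIn x) Ts) ⊑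
                   N ⊙ (λ x → sumAll (Towards.spineBranch r k x) Ts) ⊕
               D ⊙ (λ x → sumAll (Towards.frontierBranch r k x) Ts)

  -- The children's estimate is a hypothesis, which keeps this step outside the recursion and lets
  -- both recursive bounds share it.
  node-bound : ∀ r k {S c} (c∈S : c ∈ S) {Hs} (uniq : Unique Hs)
               (comps : ∀ H → H List.∈ Hs ⇔ IsComponent G (S - c) H) Ts →
               N ⊙ (λ x → sumAll (depthIn x) Ts) ⊑
               N ⊙ (λ x → sumAll (Towards.spineBranch r k x) Ts) ⊕
               D ⊙ (λ x → sumAll (Towards.frontierBranch r k x) Ts) →
               N ⊙ (λ x → depthIn x (node c c∈S Hs uniq comps Ts)) ⊑
               N ⊙ Towards.spine r (suc k) (node c c∈S Hs uniq comps Ts) ⊕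
               D ⊙ Towards.frontier r (suc k) (node c c∈S Hs uniq comps Ts)
  node-bound r k {S} {c} c∈S {Hs} uniq comps Ts ih =
    ⊑-trans (≤⇒⊑ w≥0 λ x → ℕ.≤-trans
      (ℕ.*-monoʳ-≤ N (depthIn-node c∈S uniq comps Ts x))
      (ℕ.≤-reflexive (ℕ.*-distribˡ-+ N (χ S x) (sumAll (depthIn x) Ts))))
    (⊑-trans (⊕-mono {a = N ⊙ χ S} (⊑-refl w≥0) ih)
    (≤⇒⊑ w≥0 λ x → ℕ.≤-reflexive
      (solve 5 (λ N D s p q → N :* s :+ (N :* p :+ D :* q) := N :* (s :+ p) :+ D :* q) refl
        N D (χ S x) (sumAll (spineBranch k x) Ts) (sumAll (frontierBranch k x) Ts))))
    where
    open Towards r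
    open +-*-Solver

  path-bound r zero {S} T con centroid =
    ⊑-trans (depthIn-bound T con centroid) (≤⇒⊑ w≥0 λ x → ℕ.m≤n+m (D ℕ.* own S x) (N ℕ.* 0))
  path-bound r (suc k) (node c c∈S Hs uniq comps Ts) con centroid =
    node-bound r k c∈S uniq comps Ts (branches-bound r k Ts
      (λ {H} m → proj₁ (proj₂ (Equivalence.to (comps H) m))) (centroid-child {Ts = Ts} centroid))

  branches-bound r k [] _ _ = ≤⇒⊑ w≥0 λ x → ℕ.≤-trans (ℕ.≤-reflexive (ℕ.*-zeroʳ N)) z≤n
  branches-bound r k (_∷_ {x = H} T Ts) con centroid =
    ⊑-trans (≤⇒⊑ w≥0 λ x → ℕ.≤-reflexive (ℕ.*-distribˡ-+ N (depthIn x T) (sumAll (depthIn x) Ts)))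
    (⊑-trans (⊕-mono (branch (r ∈? H)) (branches-bound r k Ts (con ∘ there) (centroid ∘ there)))
    (≤⇒⊑ w≥0 λ x → ℕ.≤-reflexive
      (solve 6 (λ N D p q p′ q′ → (N :* p :+ D :* q) :+ (N :* p′ :+ D :* q′) :=
                                  N :* (p :+ p′) :+ D :* (q :+ q′)) refl
        N D (spineBranch k x T) (frontierBranch k x T)
        (sumAll (spineBranch k x) Ts) (sumAll (frontierBranch k x) Ts))))
    where
    open Towards r
    open +-*-Solver using (solve; _:=_; _:+_; _:*_)

    branch : Dec (r ∈ H) → N ⊙ (λ x → depthIn x T) ⊑
                           N ⊙ (λ x → spineBranch k x T) ⊕ D ⊙ (λ x → frontierBranch k x T)
    branch (yes r∈H) = ⊑-trans (path-bound r k T (con (here refl)) (centroid (here refl)))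
      (≤⇒⊑ w≥0 λ x → ℕ.≤-reflexive (sym (cong₂ (λ p q → N ℕ.* p ℕ.+ D ℕ.* q)
        (spineBranch-towards k x T r∈H) (frontierBranch-towards k x T r∈H))))
    branch (no r∉H) = ⊑-trans (depthIn-bound T (con (here refl)) (centroid (here refl)))
      (≤⇒⊑ w≥0 λ x → ℕ.≤-trans
        (ℕ.≤-reflexive (cong (D ℕ.*_) (sym (frontierBranch-aside k x T r∉H))))
        (ℕ.m≤n+m (D ℕ.* frontierBranch k x T) (N ℕ.* spineBranch k x T)))

  depthIn-bound {S} T@(node c c∈S Hs uniq comps Ts) con centroid =
    -- This is `path-bound` for `suc Δ` steps with the first one unfolded, so that the recursion
    -- visibly passes to the children.
    ⊑-trans (node-bound r Δ c∈S uniq comps Ts (branches-bound r Δ Ts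
      (λ {H} m → proj₁ (proj₂ (Equivalence.to (comps H) m))) (centroid-child {Ts = Ts} centroid)))
    (⊑-trans (⊕-mono {c = D ⊙ frontier (suc Δ) T} (spine-bound Δ T centroid) (⊑-refl w≥0))
    (⊑-trans (≤⇒⊑ w≥0 λ x → ℕ.≤-reflexive (trans
        (ℕ.+-comm (D ℕ.* χ S x) (D ℕ.* frontier (suc Δ) T x))
        (sym (ℕ.*-distribˡ-+ D (frontier (suc Δ) T x) (χ S x)))))
      (⊙-monoʳ w≥0 D (frontier-bound T con centroid (proj₁ (proj₂ (top con))) (proj₂ (proj₂ (top con)))))))
    where
    r : Fin n
    r = proj₁ (top con)
    open Towards r

-- From coefficients back to costs

degree≤maxDegree : ∀ {n} (G : Graph n) v → degree G v ℕ.≤ maxDegree G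
degree≤maxDegree {n} G v =
  All.lookup (xs≤max 0 (map (degree G) (allFin n))) (∈-map⁺ (degree G) (∈-allFin v))

-- The inductive estimate on the whole vertex set, with `up` the ancestor sets of `T`, whose sizes
-- are at most the depths.
cost-bound : ∀ {n} (G : Graph n) → Connected G ⊤ → (w : Fin n → ℝ) → (∀ x → 0ℝ ≤ w x) →
             (C T : SearchTree G ⊤) → IsCentroidTree G w C →
             (λ i → (2 ℕ.^ maxDegree G) × seq (cost G w C) i) ≲
             (λ i → spineCoefficient (maxDegree G) × seq (cost G w T) i)
cost-bound {n} G con w w≥0 C T centroid =
  ≲-trans (≲-reflexive (scaled (2 ℕ.^ maxDegree G) C))
  (≲-trans (weigh (⊑-trans (depthIn-bound C con centroid) (⊙-monoʳ w≥0 (spineCoefficient (maxDegree G)) (≤⇒⊑ w≥0 own≤))))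
  (≲-reflexive λ i → sym (scaled (spineCoefficient (maxDegree G)) T i)))
  where
  open Weighted w
  open Trees G
  open Costs G (ancestors T) using (own)
  highest : ∀ {K} → Connected G K → ∃ λ t → t ∈ K ∧ (∀ {x} → x ∈ K → t ∈ ancestors T x)
  highest con = top T con λ _ → ∈⊤

  open Bound G (ancestors T) highest w w≥0 (maxDegree G) (degree≤maxDegree G)

  own≤ : ∀ x → own ⊤ x ℕ.≤ depthIn x T
  own≤ x = ℕ.*-monoʳ-≤ (χ ⊤ x) (ℕ.≤-trans (∣p∩q∣≤∣p∣ (ancestors T x) ⊤) (∣ancestors∣≤depth T x))

  scaled : ∀ k (T : SearchTree G ⊤) i →
           k × seq (cost G w T) i ≡ ⟦ k ⊙ (λ x → depthIn x T) ⟧ i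
  scaled k T i = trans (cong (k ×_) (sumOver-/1≡⟦⟧ ⊤ (depth G T) i))
    (sym (At.combine-⊙ i k (λ x → depthIn x T)))

theorem4 : ∀ {n : ℕ} (G : Graph n) → IsTree G →
    (w : Fin n → ℝ) → (∀ x → 0ℝ ≤ w x) →
    ∀ {cent OPT : ℝ} → IsCent G w cent → IsOPT G w OPT →
    cent ≤ ((+ 2 / 1) ℚ.- 1/2^ (maxDegree G)) · OPT
theorem4 G (con , _) w w≥0 {cent} {OPT} ((C , centroid , cost≃cent) , _) ((T , cost≃OPT) , _) =
  -- `C` attains `cent` and `T` attains `OPT`; comparing these two trees and dividing by 2^Δ gives
  -- the ratio.
  bound (×-cancel-≲ (2 ℕ.^ Δ) {{ℕ.m^n≢0 2 Δ}}
    (≲-trans (×-monoʳ-≲ (2 ℕ.^ Δ) (≃⇒≳ (cost G w C) cent cost≃cent))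
    (≲-trans (cost-bound G con w w≥0 C T centroid)
    (≲-trans (×-monoʳ-≲ (spineCoefficient Δ) (≃⇒≲ (cost G w T) OPT cost≃OPT))
    (≲-reflexive λ i → ×-ratio Δ (spineCoefficient Δ) (seq OPT i) (1+spineCoefficient Δ))))))
  where
  Δ : ℕ
  Δ = maxDegree G
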